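{- Let $r\ge 3$ and let $G$ and $F$ be $r$-graphs such that $G$ is $2$-tightly connected and $G$ is not homomorphic to $F$. Then there exists a constant $c$ depending only on $F$ such that, for all sufficiently large $n$, $$f_{F,G}(n)\le c(\log n)^{\alpha_F},\qquad\text{where}\quad \alpha_F=\max_{\emptyset\ne F'\subseteq \partial_2 F}\left\{\frac{e(F')+1}{v(F')-1}\right\},$$ the maximum being over nonempty subgraphs $F'$ of the graph $\partial_2F$.
   Context: An $r$-graph is an $r$-uniform hypergraph. An $r$-graph is $G$-free if it contains no (not necessarily induced) subgraph isomorphic to $G$. For $r$-graphs $F,G$ and $n\ge1$, $f_{F,G}(n)$ is the maximum integer $m$ such that every $n$-vertex $G$-free $r$-graph contains an $F$-free induced subgraph on $m$ vertices. An $r$-graph is $k$-tightly connected if its edges can be ordered $e_1,\dots,e_t$ so that for each $2\le i\le t$ there is $1\le j\le i-1$ with $|e_i\cap e_j|\ge k$. For an $r$-graph $H$, the $k$-shadow $\partial_k H=\bigcup_{e\in E(H)}\binom{e}{k}$ is the $k$-graph whose edges are the $k$-subsets of edges of $H$. $e(\cdot)$ and $v(\cdot)$ denote numbers of edges and vertices. $G$ is homomorphic to $F$ if there is a map $V(G)\to V(F)$ sending every edge of $G$ onto an edge of $F$. -}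

module Defs where

open import Data.Nat using (ℕ; zero; suc; _+_; _*_; _∸_; _^_; _≤_; _<_)
open import Data.Nat.Logarithm using (⌊log₂_⌋)
open import Data.Bool using (Bool; true; false; if_then_else_; _∧_)
open import Data.Fin using (Fin; toℕ)
open import Data.Fin.Subset using (Subset; inside; outside; _∈_; _⊆_; _∩_; ∣_∣) renaming (⊤ to fullSet)
open import Data.Fin.Subset.Properties using (_⊆?_)
open import Data.Vec using (_∷_; [])
open import Data.List using (List; []; _∷_; map; _++_; length; lookup)
open import Data.Nat.ListAction using (sum)
open import Data.Bool.ListAction using (any)
open import Data.List.Membership.Propositional using () renaming (_∈_ to _∈ₗ_)
open import Data.List.Relation.Unary.Unique.Propositional using (Unique)
open import Data.Nat using (_≡ᵇ_)
open import Data.Product using (Σ; ∃; _×_)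
open import Relation.Nullary using (¬_)
open import Relation.Nullary.Decidable using (⌊_⌋)
open import Relation.Binary.PropositionalEquality using (_≡_)
open import Function.Definitions using (Injective)

record RGraph (r v : ℕ) : Set where
  field
    E       : Subset v → Bool
    uniform : ∀ e → E e ≡ true → ∣ e ∣ ≡ r
open RGraph public

IsEdge : ∀ {r v} → RGraph r v → Subset v → Set
IsEdge H e = E H e ≡ true

MapsOnto : ∀ {a b} → (Fin a → Fin b) → Subset a → Subset b → Set
MapsOnto φ e f = ∀ y → (y ∈ f → ∃ λ x → x ∈ e × φ x ≡ y) × ((∃ λ x → x ∈ e × φ x ≡ y) → y ∈ f)

Homomorphic : ∀ {r a b} → RGraph r a → RGraph r b → Set
Homomorphic G F = Σ (Fin _ → Fin _) λ φ →
  ∀ e → IsEdge G e → ∃ λ f → IsEdge F f × MapsOnto φ e f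

-- H contains a (not necessarily induced) copy of G with all its vertices in S.
-- (With S the whole vertex set this is "G ⊆ H"; in general it says that the
-- induced subgraph H[S] contains a copy of G.)
CopyIn : ∀ {r a b} → RGraph r a → RGraph r b → Subset b → Set
CopyIn G H S = Σ (Fin _ → Fin _) λ φ → Injective _≡_ _≡_ φ × (∀ x → φ x ∈ S) ×
  (∀ e → IsEdge G e → ∃ λ f → IsEdge H f × MapsOnto φ e f)

Free : ∀ {r a b} → RGraph r a → RGraph r b → Set
Free G H = ¬ CopyIn G H fullSet

InducedFree : ∀ {r a b} → RGraph r a → RGraph r b → Subset b → Set
InducedFree F H S = ¬ CopyIn F H S

-- every n-vertex G-free r-graph contains an F-free induced subgraph on m vertices.
-- f_{F,G}(n) is the maximum m with this property; "f_{F,G}(n) ≤ X" means every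
-- such m is ≤ X.
GoodSize : ∀ {r a b} → RGraph r a → RGraph r b → ℕ → ℕ → Set
GoodSize {r} F G n m = (H : RGraph r n) → Free G H →
  ∃ λ (S : Subset n) → ∣ S ∣ ≡ m × InducedFree F H S

TightlyConnected : ∀ {r v} → ℕ → RGraph r v → Set
TightlyConnected k H = Σ (List (Subset _)) λ es →
  Unique es × (∀ e → e ∈ₗ es → IsEdge H e) × (∀ e → IsEdge H e → e ∈ₗ es) ×
  (∀ i → 1 ≤ toℕ i → ∃ λ j → toℕ j < toℕ i × k ≤ ∣ lookup es i ∩ lookup es j ∣)

allSubsets : (n : ℕ) → List (Subset n)
allSubsets zero = [] ∷ []
allSubsets (suc n) = map (inside ∷_) (allSubsets n) ++ map (outside ∷_) (allSubsets n)

numEdges : ∀ {v} → (Subset v → Bool) → ℕ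
numEdges {v} D = sum (map (λ s → if D s then 1 else 0) (allSubsets v))

shadow2 : ∀ {r v} → RGraph r v → RGraph 2 v
shadow2 {v = v} H = record
  { E = λ d → (∣ d ∣ ≡ᵇ 2) ∧ any (λ e → E H e ∧ ⌊ d ⊆? e ⌋) (allSubsets v)
  ; uniform = uniformProof }
  where
  open import Data.Nat.Properties using (≡ᵇ⇒≡)
  open import Data.Bool using (T)
  open import Data.Bool.Properties using (T-∧; T-≡)
  open import Function.Bundles using (Equivalence)
  uniformProof : ∀ d → ((∣ d ∣ ≡ᵇ 2) ∧ any (λ e → E H e ∧ ⌊ d ⊆? e ⌋) (allSubsets v)) ≡ true → ∣ d ∣ ≡ 2
  uniformProof d eq = ≡ᵇ⇒≡ ∣ d ∣ 2 (Data.Product.proj₁ (Equivalence.to T-∧ (Equivalence.from T-≡ eq)))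
    where import Data.Product

record Subgraph {v} (K : RGraph 2 v) : Set where
  field
    W    : Subset v
    D    : Subset v → Bool
    D⊆E  : ∀ d → D d ≡ true → IsEdge K d
    D⊆W  : ∀ d → D d ≡ true → d ⊆ W
open Subgraph public

vSub : ∀ {v} {K : RGraph 2 v} → Subgraph K → ℕ
vSub F' = ∣ W F' ∣

eSub : ∀ {v} {K : RGraph 2 v} → Subgraph K → ℕ
eSub F' = numEdges (D F')

-- F* attains α_F = max over nonempty F' ⊆ ∂₂F of (e(F')+1)/(v(F')-1)
-- (ratios compared by cross-multiplication; nonempty = at least one edge, so v ≥ 2).
IsMaximizer : ∀ {r v} (F : RGraph r v) → Subgraph (shadow2 F) → Set
IsMaximizer F F* = 1 ≤ eSub F* ×
  (∀ (F' : Subgraph (shadow2 F)) → 1 ≤ eSub F' →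
     (eSub F' + 1) * (vSub F* ∸ 1) ≤ (eSub F* + 1) * (vSub F' ∸ 1))

{-# OPTIONS --safe #-}
-- Let q be of order log n. Choose maps ψ₁, …, ψ_q from [n] to V(F) and a colouring χ of the pairs
-- of [n] with q colours, and let H consist of the r-sets e all of whose pairs have one colour i
-- and which ψ_i maps onto an edge of F. Edges sharing a pair have the same colour, so on a
-- 2-tightly connected subgraph of H some ψ_i is a homomorphism to F; hence H is G-free.
-- For random ψ every m-set M has, for some i, all its classes ψ_i⁻¹(a) ∩ M of size at least
-- s = ⌊m / 8v⌋. For random χ every family of v disjoint s-sets contains, in every colour, a
-- transversal copy of ∂₂F: Janson's argument, applied to a greedily chosen sparse family of
-- transversals, gives failure probability below n ^ (- v s) / q as soon as
-- s ^ (|J| - 1) ≥ C (log n) ^ (e(J) + 1) for all J ⊆ V(F) spanning an edge of ∂₂F, and this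
-- is what the definition of α_F provides. Probabilities are sums over all words on a finite alphabet.
module Submission where

open import Defs
open import Data.Bool using (Bool; true; false; if_then_else_; _∧_) renaming (_≟_ to _≟ᵇ_)
open import Data.Bool.ListAction using (any)
open import Data.Bool.Properties using (∨-zeroʳ; T-≡)
open import Data.Fin using (Fin; zero; suc; toℕ; inject≤; combine; remQuot; _≟_)
open import Data.Fin.Properties using (all?; any?; toℕ-injective; suc-injective; inject≤-injective; combine-injective; combine-remQuot; remQuot-combine)
open import Data.Fin.Subset using (Subset; inside; outside; ⊥; _∈_; _∉_; _⊆_; _∩_; ∣_∣)
open import Data.Fin.Subset.Properties using (_∈?_; _⊆?_; anySubset?; ∉⊥; ∣⊥∣≡0; ∣p∣≤n; p⊆q⇒∣p∣≤∣q∣; x∈p∩q⁻; ⊆-antisym)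
open import Data.List using (List; []; _∷_; _++_; length; map; filter; allFin; cartesianProductWith) renaming (lookup to lookupₗ)
open import Data.List.Membership.Propositional using () renaming (_∈_ to _∈ₗ_; _∉_ to _∉ₗ_)
open import Data.List.Membership.Propositional.Properties using (∈-map⁺; ∈-map⁻; ∈-++⁺ˡ; ∈-++⁺ʳ; ∈-++⁻; ∈-allFin; ∈-filter⁺; ∈-filter⁻; ∈-lookup; ∈-cartesianProductWith⁺)
open import Data.List.Properties using (length-map; length-++; length-filter; length-tabulate; map-tabulate)
open import Data.List.Relation.Unary.All as All using ([]; _∷_)
open import Data.List.Relation.Unary.All.Properties using (All¬⇒¬Any)
open import Data.List.Relation.Unary.AllPairs using ([]; _∷_)
open import Data.List.Relation.Unary.Any as Any using (here; there)
open import Data.List.Relation.Unary.Any.Properties using (lookup-index)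
open import Data.List.Relation.Unary.Unique.Propositional using (Unique)
import Data.List.Relation.Unary.Unique.Propositional.Properties as Unique
open import Data.Nat using (ℕ; zero; suc; pred; _+_; _*_; _∸_; _^_; _/_; _%_; _≤_; _<_; z≤n; s≤s; _≤?_; _<?_; NonZero; >-nonZero) renaming (_≟_ to _≟ℕ_)
open import Data.Nat.DivMod using (m≡m%n+[m/n]*n; m%n<n; m/n*n≤m; /-monoˡ-≤; m*n/n≡m)
open import Data.Nat.ListAction using (sum)
open import Data.Nat.Logarithm using (⌊log₂_⌋; ⌊log₂⌋-mono-≤; ⌊log₂[2^n]⌋≡n)
open import Data.Nat.Properties hiding (_≟_; suc-injective)
open import Data.Nat.Tactic.RingSolver using (solve-∀)
open import Data.Product using (∃; _×_; _,_; proj₁; proj₂; uncurry)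
open import Data.Sum using (_⊎_; inj₁; inj₂; [_,_]′) renaming (map to map-⊎)
open import Data.Vec as Vec using (Vec; []; _∷_; here; there; lookup; tabulate; zipWith; _[_]≔_)
open import Data.Vec.Properties using (∷-injectiveˡ; ∷-injectiveʳ; []=⇒lookup; lookup⇒[]=; lookup-map; lookup-zipWith; lookup∘tabulate; lookup∘update; lookup∘update′)
open import Function using (_∘_; id; case_of_)
open import Function.Bundles using (Equivalence)
open import Function.Definitions using (Injective)
open import Relation.Binary.PropositionalEquality using (_≡_; _≢_; refl; sym; trans; cong; cong₂; subst; module ≡-Reasoning)
open import Relation.Nullary using (¬_; Dec; yes; no; does; contradiction; ¬?; _×-dec_; _→-dec_)
open import Relation.Nullary.Decidable using (⌊_⌋; dec-true; isYes≗does; map′)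

-- A single random `ψ` leaves a given m-set unbalanced with probability exponentially small in m
-- only, which loses against up to n ^ m sets. About log n independent maps make the union bound
-- work, and this fixes the order of q. The price is that every map needs its own colour, so a pair
-- has a prescribed colour with probability only 1 / q: this is the source of the factor (log n) ^
-- e(J). The union bound for `χ` runs over arrays of `v * s` vertices, hence demands an exponent of
-- order s log n. Comparing it with s ^ |J| / q ^ e(J), the exponent in Janson's bound at the worst
-- J, produces the -1 and the +1 in α_F. Janson's inequality is needed without real exponentials. In
-- the sparse family each new event, once it occurs, makes at most half a dependent earlier event
-- expected. Hence each member multiplies the failure probability by at most 1 - 1 / (2 q ^ e),
-- where e counts the edges of ∂₂F, and all estimates become inequalities of natural numbers with
-- denominators cleared.

-- Sums over finite lists and over words

private
  variable A B : Set

∑ : List A → (A → ℕ) → ℕ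
∑ []       f = 0
∑ (x ∷ xs) f = f x + ∑ xs f

∑-mono-∈ : ∀ (xs : List A) {f g} → (∀ x → x ∈ₗ xs → f x ≤ g x) → ∑ xs f ≤ ∑ xs g
∑-mono-∈ []       f≤g = z≤n
∑-mono-∈ (x ∷ xs) f≤g = +-mono-≤ (f≤g x (here refl)) (∑-mono-∈ xs λ y → f≤g y ∘ there)

∑-mono : ∀ (xs : List A) {f g} → (∀ x → f x ≤ g x) → ∑ xs f ≤ ∑ xs g
∑-mono xs f≤g = ∑-mono-∈ xs λ x _ → f≤g x

∑-cong : ∀ (xs : List A) {f g} → (∀ x → f x ≡ g x) → ∑ xs f ≡ ∑ xs g
∑-cong []       f≡g = refl
∑-cong (x ∷ xs) f≡g = cong₂ _+_ (f≡g x) (∑-cong xs f≡g)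

∑-+ : ∀ (xs : List A) f g → ∑ xs (λ x → f x + g x) ≡ ∑ xs f + ∑ xs g
∑-+ []       f g = refl
∑-+ (x ∷ xs) f g rewrite ∑-+ xs f g = interchange (f x) (g x) (∑ xs f) (∑ xs g)
  where
  interchange : ∀ a b c d → a + b + (c + d) ≡ a + c + (b + d)
  interchange = solve-∀

∑-*ˡ : ∀ (xs : List A) c f → ∑ xs (λ x → c * f x) ≡ c * ∑ xs f
∑-*ˡ []       c f = sym (*-zeroʳ c)
∑-*ˡ (x ∷ xs) c f rewrite ∑-*ˡ xs c f = sym (*-distribˡ-+ c (f x) (∑ xs f))

∑-*ʳ : ∀ (xs : List A) c f → ∑ xs (λ x → f x * c) ≡ ∑ xs f * c
∑-*ʳ xs c f = trans (∑-cong xs λ x → *-comm (f x) c) (trans (∑-*ˡ xs c f) (*-comm c _))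

∑-const : ∀ (xs : List A) c → ∑ xs (λ _ → c) ≡ length xs * c
∑-const []       c = refl
∑-const (x ∷ xs) c = cong (c +_) (∑-const xs c)

∑-++ : ∀ (xs ys : List A) f → ∑ (xs ++ ys) f ≡ ∑ xs f + ∑ ys f
∑-++ []       ys f = refl
∑-++ (x ∷ xs) ys f = trans (cong (f x +_) (∑-++ xs ys f)) (sym (+-assoc (f x) _ _))

∑-map : ∀ (xs : List B) (h : B → A) f → ∑ (map h xs) f ≡ ∑ xs (f ∘ h)
∑-map []       h f = refl
∑-map (x ∷ xs) h f = cong (f (h x) +_) (∑-map xs h f)

∑-∈ : ∀ {xs : List A} {x} f → x ∈ₗ xs → f x ≤ ∑ xs f
∑-∈ f (here refl) = m≤m+n _ _
∑-∈ f (there x∈xs) = ≤-trans (∑-∈ f x∈xs) (m≤n+m _ _)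

-- The first-moment principle behind every existence claim about random choices. With `b = 1` the
-- outcome found has value 0, that is, no bad event occurs.
∑-average : ∀ (xs : List A) f b → ∑ xs f < length xs * b → ∃ λ x → f x < b
∑-average (x ∷ xs) f b lt with f x <? b
... | yes fx<b = x , fx<b
... | no  fx≮b = ∑-average xs f b
  (+-cancelˡ-< b _ _ (≤-<-trans (+-monoˡ-≤ (∑ xs f) (≮⇒≥ fx≮b)) lt))

vecs : List A → (N : ℕ) → List (Vec A N)
vecs xs zero    = [] ∷ []
vecs xs (suc N) = cartesianProductWith _∷_ xs (vecs xs N)

∑-vecs : ∀ (xs : List A) N f →
         ∑ (vecs xs (suc N)) f ≡ ∑ xs λ x → ∑ (vecs xs N) λ w → f (x ∷ w)
∑-vecs xs N f = go xs
  where
  go : ∀ ys → ∑ (cartesianProductWith _∷_ ys (vecs xs N)) f ≡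
              ∑ ys λ x → ∑ (vecs xs N) λ w → f (x ∷ w)
  go []       = refl
  go (y ∷ ys) = trans (∑-++ (map (y ∷_) (vecs xs N)) _ f)
                      (cong₂ _+_ (∑-map (vecs xs N) (y ∷_) f) (go ys))

∈-vecs : ∀ {xs : List A} → (∀ x → x ∈ₗ xs) → ∀ {N} (w : Vec A N) → w ∈ₗ vecs xs N
∈-vecs all []      = here refl
∈-vecs all (x ∷ w) = ∈-cartesianProductWith⁺ _∷_ (all x) (∈-vecs all w)

length-vecs : ∀ (xs : List A) N → length (vecs xs N) ≡ length xs ^ N
length-vecs xs zero    = refl
length-vecs xs (suc N) = begin
  length (vecs xs (suc N))                  ≡⟨ *-identityʳ _ ⟨
  length (vecs xs (suc N)) * 1              ≡⟨ ∑-const (vecs xs (suc N)) 1 ⟨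
  ∑ (vecs xs (suc N)) (λ _ → 1)             ≡⟨ ∑-vecs xs N (λ _ → 1) ⟩
  ∑ xs (λ _ → ∑ (vecs xs N) (λ _ → 1))      ≡⟨ ∑-const xs _ ⟩
  length xs * ∑ (vecs xs N) (λ _ → 1)       ≡⟨ cong (length xs *_) (∑-const (vecs xs N) 1) ⟩
  length xs * (length (vecs xs N) * 1)      ≡⟨ cong (length xs *_) (*-identityʳ _) ⟩
  length xs * length (vecs xs N)            ≡⟨ cong (length xs *_) (length-vecs xs N) ⟩
  length xs ^ suc N                         ∎
  where open ≡-Reasoning

∏ : ∀ {N} → Vec A N → (A → ℕ) → ℕ
∏ []      f = 1
∏ (x ∷ w) f = f x * ∏ w f

∑-∏ : ∀ (xs : List A) N f → ∑ (vecs xs N) (λ w → ∏ w f) ≡ ∑ xs f ^ N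
∑-∏ xs zero    f = refl
∑-∏ xs (suc N) f = begin
  ∑ (vecs xs (suc N)) (λ w → ∏ w f)              ≡⟨ ∑-vecs xs N _ ⟩
  ∑ xs (λ x → ∑ (vecs xs N) (λ w → f x * ∏ w f)) ≡⟨ ∑-cong xs (λ x → ∑-*ˡ (vecs xs N) (f x) _) ⟩
  ∑ xs (λ x → f x * ∑ (vecs xs N) (λ w → ∏ w f)) ≡⟨ ∑-*ʳ xs _ f ⟩
  ∑ xs f * ∑ (vecs xs N) (λ w → ∏ w f)           ≡⟨ cong (∑ xs f *_) (∑-∏ xs N f) ⟩
  ∑ xs f ^ suc N                                 ∎
  where open ≡-Reasoning

-- If all factors were at least `b`, the product would be at least `b ^ N`. This extracts one good
-- map from a small product over all of them.
∏-small : ∀ {N} (w : Vec A N) f b → ∏ w f < b ^ N → ∃ λ i → f (lookup w i) < b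
∏-small []      f b (s≤s ())
∏-small (x ∷ w) f b lt with f x <? b
... | yes fx<b = zero , fx<b
... | no  fx≮b with ∏-small w f b (*-cancelˡ-< b _ _ (≤-<-trans (*-monoˡ-≤ (∏ w f) (≮⇒≥ fx≮b)) lt))
...   | i , lt′ = suc i , lt′

∑-swap : ∀ (xs : List A) (ys : List B) (f : A → B → ℕ) →
         ∑ xs (λ x → ∑ ys (f x)) ≡ ∑ ys (λ y → ∑ xs (λ x → f x y))
∑-swap []       ys f = sym (trans (∑-const ys 0) (*-zeroʳ (length ys)))
∑-swap (x ∷ xs) ys f rewrite ∑-swap xs ys f = sym (∑-+ ys (f x) _)

length-allFin : ∀ n → length (allFin n) ≡ n
length-allFin n = length-tabulate id

∑-allFin-suc : ∀ n f → ∑ (allFin (suc n)) f ≡ f zero + ∑ (allFin n) (f ∘ suc)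
∑-allFin-suc n f = cong (f zero +_)
  (trans (cong (λ l → ∑ l f) (sym (map-tabulate id suc))) (∑-map (allFin n) suc f))

-- The `y` added on the left replaces the subtraction in `x + (n - 1) * y`.
∑-choice : ∀ {n} (j : Fin n) x y →
           ∑ (allFin n) (λ a → if does (a ≟ j) then x else y) + y ≡ x + n * y
∑-choice {suc n} zero x y = begin
  ∑ (allFin (suc n)) g + y              ≡⟨ cong (_+ y) (∑-allFin-suc n g) ⟩
  x + ∑ (allFin n) (λ _ → y) + y        ≡⟨ cong (λ k → x + k + y) (∑-const (allFin n) y) ⟩
  x + length (allFin n) * y + y         ≡⟨ cong (λ k → x + k * y + y) (length-allFin n) ⟩
  x + n * y + y                         ≡⟨ lemma x (n * y) y ⟩
  x + suc n * y                         ∎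
  where
  open ≡-Reasoning
  g : Fin (suc n) → ℕ
  g a = if does (a ≟ zero) then x else y
  lemma : ∀ x z y → x + z + y ≡ x + (y + z)
  lemma = solve-∀
∑-choice {suc n} (suc j) x y = begin
  ∑ (allFin (suc n)) g + y              ≡⟨ cong (_+ y) (∑-allFin-suc n g) ⟩
  y + ∑ (allFin n) (g ∘ suc) + y        ≡⟨ +-assoc y _ y ⟩
  y + (∑ (allFin n) (g ∘ suc) + y)      ≡⟨ cong (y +_) (∑-choice j x y) ⟩
  y + (x + n * y)                       ≡⟨ lemma x (n * y) y ⟩
  x + suc n * y                         ∎
  where
  open ≡-Reasoning
  g : Fin (suc n) → ℕ
  g a = if does (a ≟ suc j) then x else y
  lemma : ∀ x z y → y + (x + z) ≡ x + (y + z)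
  lemma = solve-∀

-- Colourings ψ that are balanced on every m-set

^-distribʳ-* : ∀ m n k → (m * n) ^ k ≡ m ^ k * n ^ k
^-distribʳ-* m n zero    = refl
^-distribʳ-* m n (suc k) rewrite ^-distribʳ-* m n k = interchange m n (m ^ k) (n ^ k)
  where
  interchange : ∀ a b c d → a * b * (c * d) ≡ a * c * (b * d)
  interchange = solve-∀

-- The left side consists of the two leading terms of the binomial expansion of the right side.
bernoulli : ∀ x k → x ^ suc k + suc k * x ^ k ≤ suc x ^ suc k
bernoulli x zero    = ≤-reflexive (lemma x)
  where
  lemma : ∀ x → x * 1 + 1 ≡ suc x * 1
  lemma = solve-∀
bernoulli x (suc k) = begin
  x * (x * x ^ k) + suc (suc k) * (x * x ^ k)                 ≤⟨ m≤m+n _ _ ⟩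
  x * (x * x ^ k) + suc (suc k) * (x * x ^ k) + suc k * x ^ k ≡⟨ lemma x k (x ^ k) ⟩
  suc x * (x * x ^ k + suc k * x ^ k)                         ≤⟨ *-monoʳ-≤ (suc x) (bernoulli x k) ⟩
  suc x ^ suc (suc k)                                         ∎
  where
  open ≤-Reasoning
  lemma : ∀ x k y → x * (x * y) + suc (suc k) * (x * y) + suc k * y ≡ suc x * (x * y + suc k * y)
  lemma = solve-∀

-- Integer form of (1 - 1/y) ^ y ≤ 1/2 with `y = suc x`, raised to the power `k`. Both random
-- choices draw their exponential decay from it.
power-gap : ∀ x k → 2 ^ k * x ^ (suc x * k) ≤ suc x ^ (suc x * k)
power-gap x k = begin
  2 ^ k * x ^ (suc x * k)  ≡⟨ cong (2 ^ k *_) (^-*-assoc x (suc x) k) ⟨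
  2 ^ k * (x ^ suc x) ^ k  ≡⟨ ^-distribʳ-* 2 (x ^ suc x) k ⟨
  (2 * x ^ suc x) ^ k      ≤⟨ ^-monoˡ-≤ k base ⟩
  (suc x ^ suc x) ^ k      ≡⟨ ^-*-assoc (suc x) (suc x) k ⟩
  suc x ^ (suc x * k)      ∎
  where
  open ≤-Reasoning
  base : 2 * x ^ suc x ≤ suc x ^ suc x
  base = begin
    2 * (x * x ^ x)                ≡⟨ cong (x * x ^ x +_) (+-identityʳ _) ⟩
    x * x ^ x + x * x ^ x          ≤⟨ +-monoʳ-≤ (x * x ^ x) (*-monoˡ-≤ (x ^ x) (n≤1+n x)) ⟩
    x * x ^ x + suc x * x ^ x      ≤⟨ bernoulli x x ⟩
    suc x ^ suc x                  ∎

layer : (n m : ℕ) → List (Subset n)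
layer zero    zero    = [] ∷ []
layer zero    (suc m) = []
layer (suc n) zero    = map (outside ∷_) (layer n zero)
layer (suc n) (suc m) = map (inside ∷_) (layer n m) ++ map (outside ∷_) (layer n (suc m))

∈-layer⁺ : ∀ {n} (M : Subset n) → M ∈ₗ layer n ∣ M ∣
∈-layer⁺ []            = here refl
∈-layer⁺ (inside ∷ M)  = ∈-++⁺ˡ (∈-map⁺ (inside ∷_) (∈-layer⁺ M))
∈-layer⁺ (outside ∷ M) with ∣ M ∣ | ∈-layer⁺ M
... | zero  | M∈ = ∈-map⁺ (outside ∷_) M∈
... | suc m | M∈ = ∈-++⁺ʳ (map (inside ∷_) (layer _ m)) (∈-map⁺ (outside ∷_) M∈)

∈-layer⁻ : ∀ n m {M : Subset n} → M ∈ₗ layer n m → ∣ M ∣ ≡ m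
∈-layer⁻ zero    zero    (here refl) = refl
∈-layer⁻ (suc n) zero    M∈ with ∈-map⁻ (outside ∷_) M∈
... | _ , M′∈ , refl = ∈-layer⁻ n zero M′∈
∈-layer⁻ (suc n) (suc m) M∈ with ∈-++⁻ (map (inside ∷_) (layer n m)) M∈
... | inj₁ M∈₁ with ∈-map⁻ (inside ∷_) M∈₁
...   | _ , M′∈ , refl = cong suc (∈-layer⁻ n m M′∈)
∈-layer⁻ (suc n) (suc m) M∈ | inj₂ M∈₂ with ∈-map⁻ (outside ∷_) M∈₂
...   | _ , M′∈ , refl = ∈-layer⁻ n (suc m) M′∈

length-layer : ∀ n m → length (layer n m) ≤ n ^ m
length-layer zero    zero    = ≤-refl
length-layer zero    (suc m) = z≤n
length-layer (suc n) zero    = ≤-trans (≤-reflexive (length-map _ (layer n zero))) (length-layer n zero)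
length-layer (suc n) (suc m) = begin
  length (map (inside ∷_) (layer n m) ++ map (outside ∷_) (layer n (suc m)))
    ≡⟨ length-++ (map (inside ∷_) (layer n m)) ⟩
  length (map (inside ∷_) (layer n m)) + length (map (outside ∷_) (layer n (suc m)))
    ≡⟨ cong₂ _+_ (length-map _ (layer n m)) (length-map _ (layer n (suc m))) ⟩
  length (layer n m) + length (layer n (suc m))
    ≤⟨ +-mono-≤ (length-layer n m) (length-layer n (suc m)) ⟩
  suc n * n ^ m
    ≤⟨ *-monoʳ-≤ (suc n) (^-monoˡ-≤ m (n≤1+n n)) ⟩
  suc n ^ suc m ∎
  where open ≤-Reasoning

fibre : ∀ {v n} → Vec (Fin v) n → Fin v → Subset n
fibre ψ j = Vec.map (λ a → does (a ≟ j)) ψ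

-- 2 to the number of elements of `M` outside class `j`: as in Chernoff's bound, a weight that is
-- multiplicative over coordinates, so that its mean factors.
missWeight : ∀ {v n} → Fin v → Subset n → Vec (Fin v) n → ℕ
missWeight j []            []      = 1
missWeight j (outside ∷ M) (a ∷ ψ) = missWeight j M ψ
missWeight j (inside ∷ M)  (a ∷ ψ) = (if does (a ≟ j) then 1 else 2) * missWeight j M ψ

missWeight-fibre : ∀ {v n} (j : Fin v) (M : Subset n) ψ →
                   missWeight j M ψ * 2 ^ ∣ M ∩ fibre ψ j ∣ ≡ 2 ^ ∣ M ∣
missWeight-fibre j []            []      = refl
missWeight-fibre j (outside ∷ M) (a ∷ ψ) = missWeight-fibre j M ψ
missWeight-fibre j (inside ∷ M)  (a ∷ ψ) with does (a ≟ j)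
... | true  = trans (lemma (missWeight j M ψ) _) (cong (2 *_) (missWeight-fibre j M ψ))
  where
  lemma : ∀ x y → 1 * x * (2 * y) ≡ 2 * (x * y)
  lemma = solve-∀
... | false = trans (*-assoc 2 (missWeight j M ψ) _) (cong (2 *_) (missWeight-fibre j M ψ))

-- Each element of `M` contributes the letter average (1 + 2w) / (w + 1), every other coordinate
-- contributes 1; the powers of `suc w` clear the denominators.
∑-missWeight : ∀ {w n} (j : Fin (suc w)) (M : Subset n) →
               suc w ^ ∣ M ∣ * ∑ (vecs (allFin (suc w)) n) (missWeight j M) ≡
               (1 + w * 2) ^ ∣ M ∣ * suc w ^ n
∑-missWeight     j []                      = refl
∑-missWeight {w} {suc n} j (outside ∷ M) = begin
  suc w ^ ∣ M ∣ * ∑ (vecs vs (suc n)) (missWeight j (outside ∷ M))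
    ≡⟨ cong (suc w ^ ∣ M ∣ *_) (trans (∑-vecs vs n (missWeight j (outside ∷ M))) (∑-const vs X)) ⟩
  suc w ^ ∣ M ∣ * (length vs * X)
    ≡⟨ cong (λ k → suc w ^ ∣ M ∣ * (k * X)) (length-allFin (suc w)) ⟩
  suc w ^ ∣ M ∣ * (suc w * X)
    ≡⟨ lemma (suc w ^ ∣ M ∣) (suc w) X ⟩
  suc w * (suc w ^ ∣ M ∣ * X)
    ≡⟨ cong (suc w *_) (∑-missWeight j M) ⟩
  suc w * ((1 + w * 2) ^ ∣ M ∣ * suc w ^ n)
    ≡⟨ lemma (suc w) ((1 + w * 2) ^ ∣ M ∣) (suc w ^ n) ⟩
  (1 + w * 2) ^ ∣ M ∣ * suc w ^ suc n ∎
  where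
  open ≡-Reasoning
  vs = allFin (suc w)
  X = ∑ (vecs vs n) (missWeight j M)
  lemma : ∀ x y z → x * (y * z) ≡ y * (x * z)
  lemma = solve-∀
∑-missWeight {w} {suc n} j (inside ∷ M) = begin
  suc w ^ suc ∣ M ∣ * ∑ (vecs vs (suc n)) (missWeight j (inside ∷ M))
    ≡⟨ cong (suc w ^ suc ∣ M ∣ *_) (∑-vecs vs n (missWeight j (inside ∷ M))) ⟩
  suc w ^ suc ∣ M ∣ * ∑ vs (λ a → ∑ (vecs vs n) (λ ψ → c a * missWeight j M ψ))
    ≡⟨ cong (suc w ^ suc ∣ M ∣ *_) (∑-cong vs (λ a → ∑-*ˡ (vecs vs n) (c a) (missWeight j M))) ⟩
  suc w ^ suc ∣ M ∣ * ∑ vs (λ a → c a * X)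
    ≡⟨ cong (suc w ^ suc ∣ M ∣ *_) (∑-*ʳ vs X c) ⟩
  suc w ^ suc ∣ M ∣ * (∑ vs c * X)
    ≡⟨ cong (λ k → suc w ^ suc ∣ M ∣ * (k * X)) (+-cancelʳ-≡ 2 (∑ vs c) (1 + w * 2) (trans (∑-choice j 1 2) (shift w))) ⟩
  suc w ^ suc ∣ M ∣ * ((1 + w * 2) * X)
    ≡⟨ lemma₁ (suc w) (suc w ^ ∣ M ∣) (1 + w * 2) X ⟩
  (1 + w * 2) * suc w * (suc w ^ ∣ M ∣ * X)
    ≡⟨ cong ((1 + w * 2) * suc w *_) (∑-missWeight j M) ⟩
  (1 + w * 2) * suc w * ((1 + w * 2) ^ ∣ M ∣ * suc w ^ n)
    ≡⟨ lemma₂ (1 + w * 2) (suc w) ((1 + w * 2) ^ ∣ M ∣) (suc w ^ n) ⟩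
  (1 + w * 2) ^ suc ∣ M ∣ * suc w ^ suc n ∎
  where
  open ≡-Reasoning
  vs = allFin (suc w)
  X = ∑ (vecs vs n) (missWeight j M)
  c : Fin (suc w) → ℕ
  c a = if does (a ≟ j) then 1 else 2
  shift : ∀ w → 1 + suc w * 2 ≡ 1 + w * 2 + 2
  shift = solve-∀
  lemma₁ : ∀ a b c d → a * b * (c * d) ≡ c * a * (b * d)
  lemma₁ = solve-∀
  lemma₂ : ∀ a b c d → a * b * (c * d) ≡ a * c * (b * d)
  lemma₂ = solve-∀

-- First moment over all Ψ of the weights 2 ^ #misses, which exceed 2 ^ (m ∸ s) as soon as
-- some value is taken fewer than s times.
balanced : ∀ w n s d q →
           n ^ (s + d) * (suc w * (1 + w * 2) ^ (s + d)) ^ q < (suc w ^ (s + d) * 2 ^ d) ^ q →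
           ∃ λ (Ψ : Vec (Vec (Fin (suc w)) n) q) → ∀ (M : Subset n) → ∣ M ∣ ≡ s + d →
           ∃ λ i → ∀ j → s ≤ ∣ M ∩ fibre (lookup Ψ i) j ∣
balanced w n s d q bound with ∑-average Ω total ((2 ^ d) ^ q) small
  where
  v = suc w
  m = s + d
  vs = vecs (allFin v) n
  Ω = vecs vs q
  weight : Subset n → Vec (Fin v) n → ℕ
  weight M ψ = ∑ (allFin v) λ j → missWeight j M ψ
  -- The product over the `q` independent maps is what beats the number of sets `M`: a product below
  -- `(2 ^ d) ^ q` has a factor below `2 ^ d`.
  total : Vec (Vec (Fin v) n) q → ℕ
  total Ψ = ∑ (layer n m) λ M → ∏ Ψ (weight M)
  X : ℕ
  X = v * ((1 + w * 2) ^ m * v ^ n)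
  ∑-weight : ∀ M → v ^ ∣ M ∣ * ∑ vs (weight M) ≡ v * ((1 + w * 2) ^ ∣ M ∣ * v ^ n)
  ∑-weight M = begin
    v ^ ∣ M ∣ * ∑ vs (weight M)
      ≡⟨ cong (v ^ ∣ M ∣ *_) (∑-swap vs (allFin v) (λ ψ j → missWeight j M ψ)) ⟩
    v ^ ∣ M ∣ * ∑ (allFin v) (λ j → ∑ vs (missWeight j M))
      ≡⟨ ∑-*ˡ (allFin v) (v ^ ∣ M ∣) _ ⟨
    ∑ (allFin v) (λ j → v ^ ∣ M ∣ * ∑ vs (missWeight j M))
      ≡⟨ ∑-cong (allFin v) (λ j → ∑-missWeight j M) ⟩
    ∑ (allFin v) (λ j → (1 + w * 2) ^ ∣ M ∣ * v ^ n)
      ≡⟨ ∑-const (allFin v) _ ⟩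
    length (allFin v) * ((1 + w * 2) ^ ∣ M ∣ * v ^ n)
      ≡⟨ cong (_* ((1 + w * 2) ^ ∣ M ∣ * v ^ n)) (length-allFin v) ⟩
    v * ((1 + w * 2) ^ ∣ M ∣ * v ^ n) ∎
    where open ≡-Reasoning
  ∑-total : (v ^ m) ^ q * ∑ Ω total ≤ n ^ m * X ^ q
  ∑-total = begin
    (v ^ m) ^ q * ∑ Ω total
      ≡⟨ cong ((v ^ m) ^ q *_) (∑-swap Ω (layer n m) (λ Ψ M → ∏ Ψ (weight M))) ⟩
    (v ^ m) ^ q * ∑ (layer n m) (λ M → ∑ Ω (λ Ψ → ∏ Ψ (weight M)))
      ≡⟨ cong ((v ^ m) ^ q *_) (∑-cong (layer n m) (λ M → ∑-∏ vs q (weight M))) ⟩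
    (v ^ m) ^ q * ∑ (layer n m) (λ M → ∑ vs (weight M) ^ q)
      ≡⟨ ∑-*ˡ (layer n m) ((v ^ m) ^ q) _ ⟨
    ∑ (layer n m) (λ M → (v ^ m) ^ q * ∑ vs (weight M) ^ q)
      ≤⟨ ∑-mono-∈ (layer n m) (λ M M∈ → ≤-reflexive (trans (sym (^-distribʳ-* (v ^ m) _ q))
           (cong (_^ q) (subst (λ k → v ^ k * ∑ vs (weight M) ≡ v * ((1 + w * 2) ^ k * v ^ n)) (∈-layer⁻ n m M∈) (∑-weight M))))) ⟩
    ∑ (layer n m) (λ _ → X ^ q)
      ≡⟨ ∑-const (layer n m) (X ^ q) ⟩
    length (layer n m) * X ^ q
      ≤⟨ *-monoˡ-≤ (X ^ q) (length-layer n m) ⟩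
    n ^ m * X ^ q ∎
    where open ≤-Reasoning
  instance
    vn≢0 : NonZero ((v ^ n) ^ q)
    vn≢0 = m^n≢0 (v ^ n) q {{m^n≢0 v n}}
  small : ∑ Ω total < length Ω * (2 ^ d) ^ q
  small = *-cancelˡ-< ((v ^ m) ^ q) _ _ (begin-strict
    (v ^ m) ^ q * ∑ Ω total
      ≤⟨ ∑-total ⟩
    n ^ m * X ^ q
      ≡⟨ cong (n ^ m *_) (trans (cong (_^ q) (sym (*-assoc v ((1 + w * 2) ^ m) (v ^ n)))) (^-distribʳ-* (v * (1 + w * 2) ^ m) (v ^ n) q)) ⟩
    n ^ m * ((v * (1 + w * 2) ^ m) ^ q * (v ^ n) ^ q)
      ≡⟨ *-assoc (n ^ m) _ _ ⟨
    n ^ m * (v * (1 + w * 2) ^ m) ^ q * (v ^ n) ^ q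
      <⟨ *-monoˡ-< ((v ^ n) ^ q) bound ⟩
    (v ^ m * 2 ^ d) ^ q * (v ^ n) ^ q
      ≡⟨ cong (_* (v ^ n) ^ q) (^-distribʳ-* (v ^ m) (2 ^ d) q) ⟩
    (v ^ m) ^ q * (2 ^ d) ^ q * (v ^ n) ^ q
      ≡⟨ lemma ((v ^ m) ^ q) ((2 ^ d) ^ q) ((v ^ n) ^ q) ⟩
    (v ^ m) ^ q * ((v ^ n) ^ q * (2 ^ d) ^ q)
      ≡⟨ cong (λ k → (v ^ m) ^ q * (k * (2 ^ d) ^ q)) (sym lengthΩ) ⟩
    (v ^ m) ^ q * (length Ω * (2 ^ d) ^ q) ∎)
    where
    open ≤-Reasoning
    lemma : ∀ a b c → a * b * c ≡ a * (c * b)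
    lemma = solve-∀
    lengthΩ : length Ω ≡ (v ^ n) ^ q
    lengthΩ = trans (length-vecs vs q) (cong (_^ q)
      (trans (length-vecs (allFin v) n) (cong (_^ n) (length-allFin v))))
... | Ψ , total< = Ψ , λ M ∣M∣≡m → let (i , lt) = ∏-small Ψ _ (2 ^ d) (≤-<-trans (∑-∈ _ (M∈layer M ∣M∣≡m)) total<)
                                    in i , λ j → many M (lookup Ψ i) j ∣M∣≡m lt
  where
  M∈layer : ∀ M → ∣ M ∣ ≡ s + d → M ∈ₗ layer n (s + d)
  M∈layer M ∣M∣≡m = subst (λ k → M ∈ₗ layer n k) ∣M∣≡m (∈-layer⁺ M)
  many : ∀ M ψ j → ∣ M ∣ ≡ s + d → ∑ (allFin (suc w)) (λ j → missWeight j M ψ) < 2 ^ d → s ≤ ∣ M ∩ fibre ψ j ∣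
  many M ψ j ∣M∣≡m lt = ≮⇒≥ λ few → <-irrefl refl (begin-strict
    2 ^ (s + d)                                  ≡⟨ cong (2 ^_) ∣M∣≡m ⟨
    2 ^ ∣ M ∣                                    ≡⟨ missWeight-fibre j M ψ ⟨
    missWeight j M ψ * 2 ^ ∣ M ∩ fibre ψ j ∣     ≤⟨ *-monoʳ-≤ (missWeight j M ψ) (^-monoʳ-≤ 2 (<⇒≤ few)) ⟩
    missWeight j M ψ * 2 ^ s                     <⟨ *-monoˡ-< (2 ^ s) {{m^n≢0 2 s}} (≤-<-trans (∑-∈ (λ j → missWeight j M ψ) (∈-allFin j)) lt) ⟩
    2 ^ d * 2 ^ s                                ≡⟨ *-comm (2 ^ d) (2 ^ s) ⟩
    2 ^ s * 2 ^ d                                ≡⟨ ^-distribˡ-+-* 2 s d ⟨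
    2 ^ (s + d)                                  ∎)
    where open ≤-Reasoning

-- Cylinder events in a uniformly random word

hit : ∀ {q} → Fin q → Fin q → ℕ
hit i a = if does (a ≟ i) then 1 else 0

hit-self : ∀ {q} (i : Fin q) → hit i i ≡ 1
hit-self i with i ≟ i
... | yes _   = refl
... | no  i≢i = contradiction refl i≢i

hit≤1 : ∀ {q} (i a : Fin q) → hit i a ≤ 1
hit≤1 i a with does (a ≟ i)
... | true  = ≤-refl
... | false = z≤n

∑-hit : ∀ {q} (i : Fin q) (f : Fin q → ℕ) → ∑ (allFin q) (λ a → hit i a * f a) ≡ f i
∑-hit {q} i f = +-cancelʳ-≡ 0 _ _ (begin
  ∑ (allFin q) (λ a → hit i a * f a) + 0                    ≡⟨ cong (_+ 0) (∑-cong (allFin q) pointwise) ⟩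
  ∑ (allFin q) (λ a → if does (a ≟ i) then f i else 0) + 0  ≡⟨ ∑-choice i (f i) 0 ⟩
  f i + q * 0                                               ≡⟨ cong (f i +_) (*-zeroʳ q) ⟩
  f i + 0                                                   ∎)
  where
  open ≡-Reasoning
  pointwise : ∀ a → hit i a * f a ≡ (if does (a ≟ i) then f i else 0)
  pointwise a with a ≟ i
  ... | yes refl = +-identityʳ _
  ... | no  _    = refl

cylinder : ∀ {q N} → Fin q → List (Fin N) → Vec (Fin q) N → ℕ
cylinder i []      ω = 1
cylinder i (k ∷ l) ω = hit i (lookup ω k) * cylinder i l ω

cylinder≤1 : ∀ {q N} (i : Fin q) (l : List (Fin N)) ω → cylinder i l ω ≤ 1
cylinder≤1 i []      ω = ≤-refl
cylinder≤1 i (k ∷ l) ω = *-mono-≤ (hit≤1 i (lookup ω k)) (cylinder≤1 i l ω)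

cylinder-++ : ∀ {q N} (i : Fin q) (l l′ : List (Fin N)) ω →
              cylinder i (l ++ l′) ω ≡ cylinder i l ω * cylinder i l′ ω
cylinder-++ i []      l′ ω = sym (+-identityʳ _)
cylinder-++ i (k ∷ l) l′ ω = trans (cong (hit i (lookup ω k) *_) (cylinder-++ i l l′ ω))
                                   (sym (*-assoc (hit i (lookup ω k)) _ _))

cylinder-update-∉ : ∀ {q N} (i : Fin q) {k : Fin N} {l} → k ∉ₗ l → ∀ a ω →
                    cylinder i l (ω [ k ]≔ a) ≡ cylinder i l ω
cylinder-update-∉ i {l = []}     k∉ a ω = refl
cylinder-update-∉ i {k} {k′ ∷ l} k∉ a ω = cong₂ _*_
  (cong (hit i) (lookup∘update′ (λ k′≡k → k∉ (here (sym k′≡k))) ω a))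
  (cylinder-update-∉ i (k∉ ∘ there) a ω)

cylinder-update-mono : ∀ {q N} (i : Fin q) (k : Fin N) l ω →
                       cylinder i l ω ≤ cylinder i l (ω [ k ]≔ i)
cylinder-update-mono i k []       ω = ≤-refl
cylinder-update-mono i k (k′ ∷ l) ω = *-mono-≤ step (cylinder-update-mono i k l ω)
  where
  step : hit i (lookup ω k′) ≤ hit i (lookup (ω [ k ]≔ i) k′)
  step with k′ ≟ k
  ... | yes refl rewrite lookup∘update k ω i | hit-self i = hit≤1 i (lookup ω k)
  ... | no  k′≢k rewrite lookup∘update′ k′≢k ω i = ≤-refl

cylinder-complete : ∀ {q N} (i : Fin q) (l : List (Fin N)) ω →
                    cylinder i l ω ≢ 0 → ∀ {k} → k ∈ₗ l → lookup ω k ≡ i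
cylinder-complete i (k ∷ l) ω ≢0 k∈ with lookup ω k ≟ i
cylinder-complete i (k ∷ l) ω ≢0 (here refl) | yes eq = eq
cylinder-complete i (k ∷ l) ω ≢0 (there k∈)  | yes eq =
  cylinder-complete i l ω (≢0 ∘ λ z → trans (+-identityʳ _) z) k∈
cylinder-complete i (k ∷ l) ω ≢0 k∈          | no _ = contradiction refl ≢0

-- Overwriting position `k` by `i` is `q`-to-one onto the words with letter `i` there, so
-- conditioning on that letter becomes substitution.
∑-resample : ∀ {q N} (i : Fin q) (k : Fin N) (h : Vec (Fin q) N → ℕ) →
             q * ∑ (vecs (allFin q) N) (λ ω → hit i (lookup ω k) * h ω) ≡
             ∑ (vecs (allFin q) N) (λ ω → h (ω [ k ]≔ i))
∑-resample {q} {suc N} i zero h = begin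
  q * ∑ (vecs qs (suc N)) (λ ω → hit i (lookup ω zero) * h ω)
    ≡⟨ cong (q *_) (∑-vecs qs N (λ ω → hit i (lookup ω zero) * h ω)) ⟩
  q * ∑ qs (λ a → ∑ (vecs qs N) (λ ω → hit i a * h (a ∷ ω)))
    ≡⟨ cong (q *_) (∑-cong qs (λ a → ∑-*ˡ (vecs qs N) (hit i a) _)) ⟩
  q * ∑ qs (λ a → hit i a * ∑ (vecs qs N) (λ ω → h (a ∷ ω)))
    ≡⟨ cong (q *_) (∑-hit i (λ a → ∑ (vecs qs N) (λ ω → h (a ∷ ω)))) ⟩
  q * ∑ (vecs qs N) (λ ω → h (i ∷ ω))
    ≡⟨ cong (_* ∑ (vecs qs N) (λ ω → h (i ∷ ω))) (length-allFin q) ⟨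
  length qs * ∑ (vecs qs N) (λ ω → h (i ∷ ω))
    ≡⟨ ∑-const qs _ ⟨
  ∑ qs (λ _ → ∑ (vecs qs N) (λ ω → h (i ∷ ω)))
    ≡⟨ ∑-vecs qs N (λ ω → h (ω [ zero ]≔ i)) ⟨
  ∑ (vecs qs (suc N)) (λ ω → h (ω [ zero ]≔ i)) ∎
  where
  open ≡-Reasoning
  qs = allFin q
∑-resample {q} {suc N} i (suc k) h = begin
  q * ∑ (vecs qs (suc N)) (λ ω → hit i (lookup ω (suc k)) * h ω)
    ≡⟨ cong (q *_) (∑-vecs qs N (λ ω → hit i (lookup ω (suc k)) * h ω)) ⟩
  q * ∑ qs (λ a → ∑ (vecs qs N) (λ ω → hit i (lookup ω k) * h (a ∷ ω)))
    ≡⟨ ∑-*ˡ qs q _ ⟨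
  ∑ qs (λ a → q * ∑ (vecs qs N) (λ ω → hit i (lookup ω k) * h (a ∷ ω)))
    ≡⟨ ∑-cong qs (λ a → ∑-resample i k (h ∘ (a ∷_))) ⟩
  ∑ qs (λ a → ∑ (vecs qs N) (λ ω → h (a ∷ (ω [ k ]≔ i))))
    ≡⟨ ∑-vecs qs N (λ ω → h (ω [ suc k ]≔ i)) ⟨
  ∑ (vecs qs (suc N)) (λ ω → h (ω [ suc k ]≔ i)) ∎
  where
  open ≡-Reasoning
  qs = allFin q

module _ {q N : ℕ} (i : Fin q) (h : Vec (Fin q) N → ℕ) where

  private
    Ω : List (Vec (Fin q) N)
    Ω = vecs (allFin q) N

    swap-in : ∀ k l → q ^ length (k ∷ l) * ∑ Ω (λ ω → cylinder i (k ∷ l) ω * h ω) ≡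
                      q ^ length l * ∑ Ω (λ ω → cylinder i l (ω [ k ]≔ i) * h (ω [ k ]≔ i))
    swap-in k l = begin
      q * q ^ length l * ∑ Ω (λ ω → hit i (lookup ω k) * cylinder i l ω * h ω)
        ≡⟨ lemma q (q ^ length l) _ ⟩
      q ^ length l * (q * ∑ Ω (λ ω → hit i (lookup ω k) * cylinder i l ω * h ω))
        ≡⟨ cong (λ z → q ^ length l * (q * z)) (∑-cong Ω (λ ω → *-assoc (hit i (lookup ω k)) _ _)) ⟩
      q ^ length l * (q * ∑ Ω (λ ω → hit i (lookup ω k) * (cylinder i l ω * h ω)))
        ≡⟨ cong (q ^ length l *_) (∑-resample i k (λ ω → cylinder i l ω * h ω)) ⟩
      q ^ length l * ∑ Ω (λ ω → cylinder i l (ω [ k ]≔ i) * h (ω [ k ]≔ i)) ∎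
      where
      open ≡-Reasoning
      lemma : ∀ a b c → a * b * c ≡ b * (a * c)
      lemma = solve-∀

  -- The case of Harris' inequality in which the increasing event is a cylinder.
  cylinder-decreasing : ∀ l → Unique l → (∀ k → k ∈ₗ l → ∀ ω → h (ω [ k ]≔ i) ≤ h ω) →
                        q ^ length l * ∑ Ω (λ ω → cylinder i l ω * h ω) ≤ ∑ Ω h
  cylinder-decreasing []      _            dec = ≤-reflexive (trans (+-identityʳ _) (∑-cong Ω λ ω → +-identityʳ (h ω)))
  cylinder-decreasing (k ∷ l) (k∉l ∷ uniq) dec = begin
    q ^ length (k ∷ l) * ∑ Ω (λ ω → cylinder i (k ∷ l) ω * h ω)
      ≡⟨ swap-in k l ⟩
    q ^ length l * ∑ Ω (λ ω → cylinder i l (ω [ k ]≔ i) * h (ω [ k ]≔ i))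
      ≤⟨ *-monoʳ-≤ (q ^ length l) (∑-mono Ω λ ω → *-mono-≤
           (≤-reflexive (cylinder-update-∉ i (All¬⇒¬Any k∉l) i ω)) (dec k (here refl) ω)) ⟩
    q ^ length l * ∑ Ω (λ ω → cylinder i l ω * h ω)
      ≤⟨ cylinder-decreasing l uniq (λ k′ → dec k′ ∘ there) ⟩
    ∑ Ω h ∎
    where open ≤-Reasoning

  -- The opposite monotonicity reverses the inequality. It is applied to events that do not read the
  -- positions in `l`, where it is one half of independence.
  cylinder-increasing : ∀ l → Unique l → (∀ k → k ∈ₗ l → ∀ ω → h ω ≤ h (ω [ k ]≔ i)) →
                        ∑ Ω h ≤ q ^ length l * ∑ Ω (λ ω → cylinder i l ω * h ω)
  cylinder-increasing []      _            inc = ≤-reflexive (sym (trans (+-identityʳ _) (∑-cong Ω λ ω → +-identityʳ (h ω))))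
  cylinder-increasing (k ∷ l) (k∉l ∷ uniq) inc = begin
    ∑ Ω h
      ≤⟨ cylinder-increasing l uniq (λ k′ → inc k′ ∘ there) ⟩
    q ^ length l * ∑ Ω (λ ω → cylinder i l ω * h ω)
      ≤⟨ *-monoʳ-≤ (q ^ length l) (∑-mono Ω λ ω → *-mono-≤
           (≤-reflexive (sym (cylinder-update-∉ i (All¬⇒¬Any k∉l) i ω))) (inc k (here refl) ω)) ⟩
    q ^ length l * ∑ Ω (λ ω → cylinder i l (ω [ k ]≔ i) * h (ω [ k ]≔ i))
      ≡⟨ swap-in k l ⟨
    q ^ length (k ∷ l) * ∑ Ω (λ ω → cylinder i (k ∷ l) ω * h ω) ∎
    where open ≤-Reasoning

-- A Janson-type inequality for sparse families of events

agree : ∀ {s v} → Vec (Fin s) v → Vec (Fin s) v → Subset v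
agree = zipWith λ a b → does (a ≟ b)

edgesIn : ∀ {v} → List (Subset v) → Subset v → List (Subset v)
edgesIn es J = filter (_⊆? J) es

shared : ∀ {s v} → List (Subset v) → Vec (Fin s) v → Vec (Fin s) v → ℕ
shared es t u = length (edgesIn es (agree t u))

-- q ^ shared es t u / q ^ length es is the probability that ∂₂F appears on u in a given colour,
-- conditionally on its appearing on t; it counts only if the two events are dependent.
penalty : ℕ → ℕ → ℕ
penalty q zero    = 0
penalty q (suc k) = q ^ suc k

-- After division by `2 * q ^ length es` the condition says: given that `t` occurs, at most 1/2 of a
-- dependent event from the tail is expected. Only the tail is constrained, which suits both the
-- greedy construction and the induction in `none-decay`.
data Sparse {s v} (q : ℕ) (es : List (Subset v)) : List (Vec (Fin s) v) → Set where
  []  : Sparse q es []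
  _∷_ : ∀ {t us} → 2 * ∑ us (λ u → penalty q (shared es t u)) ≤ q ^ length es →
        Sparse q es us → Sparse q es (t ∷ us)

length-filter-split : ∀ {v} (J : Subset v) es →
  length (filter (λ d → ¬? (d ⊆? J)) es) + length (edgesIn es J) ≡ length es
length-filter-split J []       = refl
length-filter-split J (d ∷ es) with d ⊆? J
... | yes _ = trans (+-suc _ _) (cong suc (length-filter-split J es))
... | no  _ = cong suc (length-filter-split J es)

-- With k shared edges: far retains the events independent of a fixed one, near the dependent ones.
far near : ℕ → ℕ → ℕ
far  zero    x = 1 ∸ x
far  (suc _) x = 1
near zero    x = 0
near (suc _) x = x

avoid : ∀ {q N s v} → Fin q → List (Subset v) → (Vec (Fin s) v → Subset v → Fin N) →
        List (Vec (Fin s) v) → Vec (Fin q) N → ℕ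
avoid i es coord []       ω = 1
avoid i es coord (u ∷ us) ω = (1 ∸ cylinder i (map (coord u) es) ω) * avoid i es coord us ω

module Janson {q N s v : ℕ} (i : Fin q) (es : List (Subset v)) (es! : Unique es)
  (coord : Vec (Fin s) v → Subset v → Fin N)
  -- A common position of `t` and `u` comes from an edge on which they agree. So if `shared es t u`
  -- is 0, the two events read disjoint sets of positions.
  (coord-injective : ∀ {t u d d′} → d ∈ₗ es → d′ ∈ₗ es → coord t d ≡ coord u d′ →
                     d ≡ d′ × d ⊆ agree t u)
  where

  private
    Ω : List (Vec (Fin q) N)
    Ω = vecs (allFin q) N

    e : ℕ
    e = length es

    event : Vec (Fin s) v → Vec (Fin q) N → ℕ
    event t = cylinder i (map (coord t) es)

    none : List (Vec (Fin s) v) → Vec (Fin q) N → ℕ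
    none = avoid i es coord

  noneFar : Vec (Fin s) v → List (Vec (Fin s) v) → Vec (Fin q) N → ℕ
  noneFar t []       ω = 1
  noneFar t (u ∷ us) ω = far (shared es t u) (event u ω) * noneFar t us ω

  far-decreasing : ∀ k {x y} → x ≤ y → far k y ≤ far k x
  far-decreasing zero    x≤y = ∸-monoʳ-≤ 1 x≤y
  far-decreasing (suc k) x≤y = ≤-refl

  noneFar-decreasing : ∀ t us k ω → noneFar t us (ω [ k ]≔ i) ≤ noneFar t us ω
  noneFar-decreasing t []       k ω = ≤-refl
  noneFar-decreasing t (u ∷ us) k ω = *-mono-≤
    (far-decreasing (shared es t u) (cylinder-update-mono i k (map (coord u) es) ω))
    (noneFar-decreasing t us k ω)

  map-coord-unique : ∀ t {ds} → Unique ds → (∀ {d} → d ∈ₗ ds → d ∈ₗ es) → Unique (map (coord t) ds)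
  map-coord-unique t []           ⊆es = []
  map-coord-unique t {d ∷ ds} (d∉ds ∷ ds!) ⊆es =
    All.tabulate (λ k∈ eq → let (d′ , d′∈ , k≡) = ∈-map⁻ (coord t) k∈ in
      All.lookup d∉ds d′∈ (proj₁ (coord-injective (⊆es (here refl)) (⊆es (there d′∈)) (trans eq k≡))))
    ∷ map-coord-unique t ds! (⊆es ∘ there)

  event-far-update : ∀ {t k} → k ∈ₗ map (coord t) es → ∀ u ω →
    far (shared es t u) (event u ω) ≤ far (shared es t u) (event u (ω [ k ]≔ i))
  event-far-update {t} {k} k∈ u ω with shared es t u in eq
  ... | suc _ = ≤-refl
  ... | zero  = ≤-reflexive (cong (1 ∸_) (sym (cylinder-update-∉ i k∉ i ω)))
    where
    k∉ : k ∉ₗ map (coord u) es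
    k∉ k∈′ with ∈-map⁻ (coord t) k∈ | ∈-map⁻ (coord u) k∈′
    ... | d , d∈ , refl | d′ , d′∈ , k≡ =
      <⇒≢ (∈⇒0<length (∈-filter⁺ (_⊆? agree t u) d∈ (proj₂ (coord-injective d∈ d′∈ k≡)))) (sym eq)
      where
      ∈⇒0<length : ∀ {x : Subset v} {xs} → x ∈ₗ xs → 0 < length xs
      ∈⇒0<length (here _)  = s≤s z≤n
      ∈⇒0<length (there _) = s≤s z≤n

  noneFar-independent : ∀ t us k → k ∈ₗ map (coord t) es → ∀ ω →
    noneFar t us ω ≤ noneFar t us (ω [ k ]≔ i)
  noneFar-independent t []       k k∈ ω = ≤-refl
  noneFar-independent t (u ∷ us) k k∈ ω =
    *-mono-≤ (event-far-update k∈ u ω) (noneFar-independent t us k k∈ ω)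

  none≤noneFar : ∀ t us ω → none us ω ≤ noneFar t us ω
  none≤noneFar t []       ω = ≤-refl
  none≤noneFar t (u ∷ us) ω = *-mono-≤ (lemma (shared es t u)) (none≤noneFar t us ω)
    where
    lemma : ∀ k → 1 ∸ event u ω ≤ far k (event u ω)
    lemma zero    = ≤-refl
    lemma (suc k) = m∸n≤m 1 (event u ω)

  -- Pointwise, if no far event occurs, then either no event occurs or the sum counts a near one.
  -- The factor `noneFar` stays next to the sum so that `cylinder-decreasing` can separate it
  -- afterwards.
  noneFar≤ : ∀ t us ω → noneFar t us ω ≤
    none us ω + ∑ us (λ u → near (shared es t u) (event u ω)) * noneFar t us ω
  noneFar≤ t []       ω = ≤-refl
  noneFar≤ t (u ∷ us) ω = lemma (shared es t u) (event u ω) (cylinder≤1 i (map (coord u) es) ω) (noneFar≤ t us ω)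
    where
    open ≤-Reasoning
    rearrange : ∀ y n S F → y * (n + S * F) ≡ y * n + S * (y * F)
    rearrange = solve-∀
    lemma : ∀ k x {n S F} → x ≤ 1 → F ≤ n + S * F →
            far k x * F ≤ (1 ∸ x) * n + (near k x + S) * (far k x * F)
    lemma zero x {n} {S} {F} x≤1 ih = begin
      (1 ∸ x) * F                              ≤⟨ *-monoʳ-≤ (1 ∸ x) ih ⟩
      (1 ∸ x) * (n + S * F)                    ≡⟨ rearrange (1 ∸ x) n S F ⟩
      (1 ∸ x) * n + S * ((1 ∸ x) * F)          ∎
    lemma (suc k) zero {n} {S} {F} x≤1 ih = begin
      1 * F                                    ≤⟨ *-monoʳ-≤ 1 ih ⟩
      1 * (n + S * F)                          ≡⟨ rearrange 1 n S F ⟩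
      1 * n + S * (1 * F)                      ∎
    lemma (suc k) (suc zero) {n} {S} {F} x≤1 ih = m≤m+n (1 * F) (S * (1 * F))
    lemma (suc k) (suc (suc x)) (s≤s ()) ih

  -- For dependent `t` and `u` the two cylinders together prescribe at least `2e` minus
  -- `shared es t u` distinct positions, and `noneFar` is decreasing, so Harris' inequality splits
  -- off its mass.
  near-bound : ∀ t u us →
    q ^ e * q ^ e * ∑ Ω (λ ω → event t ω * near (shared es t u) (event u ω) * noneFar t us ω) ≤
    penalty q (shared es t u) * ∑ Ω (noneFar t us)
  near-bound t u us with shared es t u in eq
  ... | zero  = ≤-reflexive (trans (cong (q ^ e * q ^ e *_) (trans
                  (∑-cong Ω λ ω → cong (_* noneFar t us ω) (*-zeroʳ (event t ω)))
                  (trans (∑-const Ω 0) (*-zeroʳ (length Ω))))) (*-zeroʳ (q ^ e * q ^ e)))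
  ... | suc k = begin
    q ^ e * q ^ e * ∑ Ω (λ ω → event t ω * event u ω * noneFar t us ω)
      ≤⟨ *-monoʳ-≤ (q ^ e * q ^ e) (∑-mono Ω λ ω → *-monoˡ-≤ (noneFar t us ω) (merge ω)) ⟩
    q ^ e * q ^ e * ∑ Ω (λ ω → cylinder i both ω * noneFar t us ω)
      ≡⟨ cong (_* ∑ Ω (λ ω → cylinder i both ω * noneFar t us ω)) exponents ⟩
    q ^ suc k * q ^ length both * ∑ Ω (λ ω → cylinder i both ω * noneFar t us ω)
      ≡⟨ *-assoc (q ^ suc k) _ _ ⟩
    q ^ suc k * (q ^ length both * ∑ Ω (λ ω → cylinder i both ω * noneFar t us ω))
      ≤⟨ *-monoʳ-≤ (q ^ suc k) (cylinder-decreasing i (noneFar t us) both both!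
           λ k′ _ → noneFar-decreasing t us k′) ⟩
    q ^ suc k * ∑ Ω (noneFar t us) ∎
    where
    open ≤-Reasoning
    fresh? = λ d → ¬? (d ⊆? agree t u)
    fresh = filter fresh? es
    -- Edges inside `agree t u` are left out for `u`, since their positions may repeat those of `t`;
    -- the remaining positions are distinct by `coord-injective`.
    both = map (coord t) es ++ map (coord u) fresh
    weaken : ∀ ds ω → cylinder i (map (coord u) ds) ω ≤ cylinder i (map (coord u) (filter fresh? ds)) ω
    weaken []       ω = ≤-refl
    weaken (d ∷ ds) ω with does (d ⊆? agree t u)
    ... | false = *-monoʳ-≤ (hit i (lookup ω (coord u d))) (weaken ds ω)
    ... | true  = ≤-trans (*-mono-≤ (hit≤1 i (lookup ω (coord u d))) (weaken ds ω)) (≤-reflexive (+-identityʳ _))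
    merge : ∀ ω → event t ω * event u ω ≤ cylinder i both ω
    merge ω = ≤-trans (*-monoʳ-≤ (event t ω) (weaken es ω))
                      (≤-reflexive (sym (cylinder-++ i (map (coord t) es) _ ω)))
    both! : Unique both
    both! = Unique.++⁺ (map-coord-unique t es! id)
      (map-coord-unique u (Unique.filter⁺ fresh? es!) (proj₁ ∘ ∈-filter⁻ fresh?))
      λ (k∈ , k∈′) → let (d  , d∈  , k≡)  = ∈-map⁻ (coord t) k∈
                         (d′ , d′∈ , k≡′) = ∈-map⁻ (coord u) k∈′
                         (d′∈es , d′⊈)    = ∈-filter⁻ fresh? d′∈
                         (d≡d′ , d⊆)      = coord-injective d∈ d′∈es (trans (sym k≡) k≡′)
                     in d′⊈ (subst (_⊆ agree t u) d≡d′ d⊆)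
    exponents : q ^ e * q ^ e ≡ q ^ suc k * q ^ length both
    exponents = begin-equality
      q ^ e * q ^ e                             ≡⟨ ^-distribˡ-+-* q e e ⟨
      q ^ (e + e)                               ≡⟨ cong (λ z → q ^ (e + z)) (length-filter-split (agree t u) es) ⟨
      q ^ (e + (length fresh + shared es t u))  ≡⟨ cong (λ z → q ^ (e + (length fresh + z))) eq ⟩
      q ^ (e + (length fresh + suc k))          ≡⟨ cong (q ^_) (rotate e (length fresh) (suc k)) ⟩
      q ^ (suc k + (e + length fresh))          ≡⟨ cong (λ z → q ^ (suc k + z)) (sym length-both) ⟩
      q ^ (suc k + length both)                 ≡⟨ ^-distribˡ-+-* q (suc k) (length both) ⟩
      q ^ suc k * q ^ length both               ∎
      where
      rotate : ∀ a b c → a + (b + c) ≡ c + (a + b)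
      rotate = solve-∀
      length-both : length both ≡ e + length fresh
      length-both = trans (length-++ (map (coord t) es))
        (cong₂ _+_ (length-map (coord t) es) (length-map (coord u) fresh))

  -- Let `F` be the mass without far events, at least that of `none us`. By independence `t` occurs
  -- on at least `F / Q` of it, and by sparsity the near events spoil at most `F / 2Q`. So `t`
  -- occurs while `us` is avoided with mass at least `F / 2Q`, and this mass is lost when `t` must
  -- be avoided too.
  none-step : .{{_ : NonZero q}} → ∀ t us → 2 * ∑ us (λ u → penalty q (shared es t u)) ≤ q ^ e →
    2 * q ^ e * ∑ Ω (none (t ∷ us)) + ∑ Ω (none us) ≤ 2 * q ^ e * ∑ Ω (none us)
  none-step t us sparse = begin
    2 * Q * ∑ Ω (none (t ∷ us)) + ∑ Ω (none us)  ≤⟨ +-monoʳ-≤ _ (≤-trans (∑-mono Ω (none≤noneFar t us)) F≤) ⟩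
    2 * Q * ∑ Ω (none (t ∷ us)) + 2 * Q * An     ≡⟨ *-distribˡ-+ (2 * Q) (∑ Ω (none (t ∷ us))) An ⟨
    2 * Q * (∑ Ω (none (t ∷ us)) + An)           ≡⟨ cong (2 * Q *_) (trans (sym (∑-+ Ω (none (t ∷ us)) _)) (∑-cong Ω partition)) ⟩
    2 * Q * ∑ Ω (none us)                        ∎
    where
    open ≤-Reasoning
    Q = q ^ e
    instance
      Q≢0 : NonZero Q
      Q≢0 = m^n≢0 q e
    F = ∑ Ω (noneFar t us)
    An = ∑ Ω (λ ω → event t ω * none us ω)
    AF = ∑ Ω (λ ω → event t ω * noneFar t us ω)
    P = ∑ us (λ u → penalty q (shared es t u))
    partition : ∀ ω → (1 ∸ event t ω) * none us ω + event t ω * none us ω ≡ none us ω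
    partition ω = trans (sym (*-distribʳ-+ (none us ω) (1 ∸ event t ω) (event t ω)))
      (trans (cong (_* none us ω) (m∸n+n≡m (cylinder≤1 i (map (coord t) es) ω))) (+-identityʳ _))
    F≤Q*AF : F ≤ Q * AF
    F≤Q*AF = subst (λ k → F ≤ q ^ k * AF) (length-map (coord t) es)
      (cylinder-increasing i (noneFar t us) (map (coord t) es) (map-coord-unique t es! id)
        (noneFar-independent t us))
    nearSum : ℕ
    nearSum = ∑ us (λ u → ∑ Ω (λ ω → event t ω * near (shared es t u) (event u ω) * noneFar t us ω))
    AF≤ : AF ≤ An + nearSum
    AF≤ = begin
      AF
        ≤⟨ ∑-mono Ω (λ ω → *-monoʳ-≤ (event t ω) (noneFar≤ t us ω)) ⟩
      ∑ Ω (λ ω → event t ω * (none us ω + ∑ us (λ u → near (shared es t u) (event u ω)) * noneFar t us ω))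
        ≡⟨ ∑-cong Ω (λ ω → *-distribˡ-+ (event t ω) _ _) ⟩
      ∑ Ω (λ ω → event t ω * none us ω + event t ω * (∑ us (λ u → near (shared es t u) (event u ω)) * noneFar t us ω))
        ≡⟨ ∑-+ Ω _ _ ⟩
      An + ∑ Ω (λ ω → event t ω * (∑ us (λ u → near (shared es t u) (event u ω)) * noneFar t us ω))
        ≡⟨ cong (An +_) (∑-cong Ω λ ω → sym (distribute ω)) ⟩
      An + ∑ Ω (λ ω → ∑ us (λ u → event t ω * near (shared es t u) (event u ω) * noneFar t us ω))
        ≡⟨ cong (An +_) (∑-swap Ω us (λ ω u → event t ω * near (shared es t u) (event u ω) * noneFar t us ω)) ⟩
      An + nearSum ∎
      where
      distribute : ∀ ω → ∑ us (λ u → event t ω * near (shared es t u) (event u ω) * noneFar t us ω) ≡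
                         event t ω * (∑ us (λ u → near (shared es t u) (event u ω)) * noneFar t us ω)
      distribute ω = trans (∑-*ʳ us (noneFar t us ω) _)
        (trans (cong (_* noneFar t us ω) (∑-*ˡ us (event t ω) _)) (*-assoc (event t ω) _ _))
    near≤ : Q * Q * nearSum ≤ P * F
    near≤ = begin
      Q * Q * nearSum ≡⟨ ∑-*ˡ us (Q * Q) _ ⟨
      ∑ us (λ u → Q * Q * ∑ Ω (λ ω → event t ω * near (shared es t u) (event u ω) * noneFar t us ω))
        ≤⟨ ∑-mono us (λ u → near-bound t u us) ⟩
      ∑ us (λ u → penalty q (shared es t u) * F) ≡⟨ ∑-*ʳ us F _ ⟩
      P * F ∎
    F≤ : F ≤ 2 * Q * An
    -- This is `An ≥ F / Q - F / 2Q` without denominators; the term `Q * F` added on both sides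
    -- replaces the subtraction.
    F≤ = *-cancelˡ-≤ Q (+-cancelʳ-≤ (Q * F) (Q * F) (Q * (2 * Q * An)) (begin
      Q * F + Q * F                        ≡⟨ double (Q * F) ⟩
      2 * (Q * F)                          ≤⟨ *-monoʳ-≤ 2 (*-monoʳ-≤ Q F≤Q*AF) ⟩
      2 * (Q * (Q * AF))                   ≤⟨ *-monoʳ-≤ 2 (*-monoʳ-≤ Q (*-monoʳ-≤ Q AF≤)) ⟩
      2 * (Q * (Q * (An + nearSum)))       ≡⟨ expand Q An nearSum ⟩
      Q * (2 * Q * An) + 2 * (Q * Q * nearSum) ≤⟨ +-monoʳ-≤ (Q * (2 * Q * An)) (*-monoʳ-≤ 2 near≤) ⟩
      Q * (2 * Q * An) + 2 * (P * F)       ≡⟨ cong (Q * (2 * Q * An) +_) (sym (*-assoc 2 P F)) ⟩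
      Q * (2 * Q * An) + 2 * P * F         ≤⟨ +-monoʳ-≤ (Q * (2 * Q * An)) (*-monoˡ-≤ F sparse) ⟩
      Q * (2 * Q * An) + Q * F             ∎))
      where
      double : ∀ x → x + x ≡ 2 * x
      double = solve-∀
      expand : ∀ Q a b → 2 * (Q * (Q * (a + b))) ≡ Q * (2 * Q * a) + 2 * (Q * Q * b)
      expand = solve-∀

  -- Writing `2 * q ^ e` as `suc X` turns the factor 1 - 1 / (2 q ^ e) of each step into
  -- `X / suc X`, the ratio treated by `power-gap`.
  none-decay : .{{_ : NonZero q}} → ∀ {X} → 2 * q ^ e ≡ suc X → ∀ {us} → Sparse q es us →
    suc X ^ length us * ∑ Ω (none us) ≤ X ^ length us * q ^ N
  none-decay {X} 2Q≡ []               = +-monoˡ-≤ 0 (≤-reflexive (trans (∑-const Ω 1)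
    (trans (*-identityʳ _) (trans (length-vecs (allFin q) N) (cong (_^ N) (length-allFin q))))))
  none-decay {X} 2Q≡ {t ∷ us} (sparse ∷ rest) = begin
    suc X * suc X ^ k * ∑ Ω (none (t ∷ us))    ≡⟨ lemma (suc X) (suc X ^ k) _ ⟩
    suc X ^ k * (suc X * ∑ Ω (none (t ∷ us)))  ≤⟨ *-monoʳ-≤ (suc X ^ k) step ⟩
    suc X ^ k * (X * ∑ Ω (none us))            ≡⟨ lemma X (suc X ^ k) _ ⟨
    X * suc X ^ k * ∑ Ω (none us)              ≡⟨ *-assoc X _ _ ⟩
    X * (suc X ^ k * ∑ Ω (none us))            ≤⟨ *-monoʳ-≤ X (none-decay 2Q≡ rest) ⟩
    X * (X ^ k * q ^ N)                        ≡⟨ *-assoc X _ _ ⟨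
    X * X ^ k * q ^ N                          ∎
    where
    open ≤-Reasoning
    k = length us
    lemma : ∀ a b c → a * b * c ≡ b * (a * c)
    lemma = solve-∀
    step : suc X * ∑ Ω (none (t ∷ us)) ≤ X * ∑ Ω (none us)
    step = +-cancelʳ-≤ (∑ Ω (none us)) _ _ (≤-trans
      (subst (λ z → z * ∑ Ω (none (t ∷ us)) + ∑ Ω (none us) ≤ z * ∑ Ω (none us)) 2Q≡ (none-step t us sparse))
      (≤-reflexive (+-comm (∑ Ω (none us)) _)))

  none≡0 : ∀ us ω → none us ω ≡ 0 → ∃ λ t → ∀ {d} → d ∈ₗ es → lookup ω (coord t d) ≡ i
  none≡0 (u ∷ us) ω eq with event u ω in ev
  ... | zero  = none≡0 us ω (trans (sym (+-identityʳ _)) eq)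
  ... | suc _ = u , λ d∈ → cylinder-complete i (map (coord u) es) ω
                  (λ z → contradiction (trans (sym z) ev) λ ()) (∈-map⁺ (coord u) d∈)

-- Sparse families of tuples and the random pair colouring

-- The sum factors over coordinates: the letter `b` contributes `s`, and the other `s - 1` letters
-- contribute 1 each.
∑-agree : ∀ {s} v (u : Vec (Fin s) v) →
          ∑ (vecs (allFin s) v) (λ t → s ^ ∣ agree t u ∣) ≤ (2 * s) ^ v
∑-agree     zero    []      = ≤-refl
∑-agree {s} (suc v) (b ∷ u) = begin
  ∑ (vecs (allFin s) (suc v)) (λ t → s ^ ∣ agree t (b ∷ u) ∣)
    ≡⟨ ∑-vecs (allFin s) v _ ⟩
  ∑ (allFin s) (λ a → ∑ (vecs (allFin s) v) (λ t → s ^ ∣ agree (a ∷ t) (b ∷ u) ∣))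
    ≡⟨ ∑-cong (allFin s) (λ a → trans (∑-cong (vecs (allFin s) v) (power-∷ a)) (∑-*ˡ (vecs (allFin s) v) (c a) _)) ⟩
  ∑ (allFin s) (λ a → c a * ∑ (vecs (allFin s) v) (λ t → s ^ ∣ agree t u ∣))
    ≡⟨ ∑-*ʳ (allFin s) _ c ⟩
  ∑ (allFin s) c * ∑ (vecs (allFin s) v) (λ t → s ^ ∣ agree t u ∣)
    ≤⟨ *-mono-≤ ∑c≤ (∑-agree v u) ⟩
  (2 * s) ^ suc v ∎
  where
  open ≤-Reasoning
  c : Fin s → ℕ
  c a = if does (a ≟ b) then s else 1
  power-∷ : ∀ a t → s ^ ∣ agree (a ∷ t) (b ∷ u) ∣ ≡ c a * s ^ ∣ agree t u ∣
  power-∷ a t with does (a ≟ b)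
  ... | true  = refl
  ... | false = sym (+-identityʳ _)
  ∑c≤ : ∑ (allFin s) c ≤ 2 * s
  ∑c≤ = begin
    ∑ (allFin s) c      ≤⟨ m≤m+n _ 1 ⟩
    ∑ (allFin s) c + 1  ≡⟨ ∑-choice b s 1 ⟩
    s + s * 1           ≡⟨ cong (s +_) (trans (*-identityʳ s) (sym (+-identityʳ s))) ⟩
    2 * s               ∎

module _ {s v : ℕ} .{{_ : NonZero s}} (q : ℕ) (es : List (Subset v)) (K R : ℕ) .{{_ : NonZero K}}
  (dense : ∀ J → 1 ≤ length (edgesIn es J) → K * q ^ length (edgesIn es J) ≤ s ^ ∣ J ∣)
  (K-large : 2 * R * 2 ^ v ≤ K * q ^ length es)
  where

  private
    T : List (Vec (Fin s) v)
    T = vecs (allFin s) v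

  -- A nonzero penalty means that `agree t u` spans an edge, so `dense` applies to it and bounds the
  -- penalty by `s ^ ∣ agree t u ∣ / K`.
  penalty-average : ∀ u → K * ∑ T (λ t → penalty q (shared es t u)) ≤ (2 * s) ^ v
  penalty-average u = begin
    K * ∑ T (λ t → penalty q (shared es t u))  ≡⟨ ∑-*ˡ T K _ ⟨
    ∑ T (λ t → K * penalty q (shared es t u))  ≤⟨ ∑-mono T pointwise ⟩
    ∑ T (λ t → s ^ ∣ agree t u ∣)              ≤⟨ ∑-agree v u ⟩
    (2 * s) ^ v                                ∎
    where
    open ≤-Reasoning
    pointwise : ∀ t → K * penalty q (shared es t u) ≤ s ^ ∣ agree t u ∣
    pointwise t with shared es t u in eq
    ... | zero  = ≤-trans (≤-reflexive (*-zeroʳ K)) z≤n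
    ... | suc k = subst (λ z → K * q ^ z ≤ s ^ ∣ agree t u ∣) eq
                    (dense (agree t u) (subst (1 ≤_) (sym eq) (s≤s z≤n)))

  -- Greedy choice: while fewer than `R` tuples are present, `K-large` keeps the average cost of a
  -- further tuple at most `q ^ length es`, so some tuple can be added.
  sparse-list : ∀ k → k ≤ R → ∃ λ us → length us ≡ k × Sparse {s} q es us
  sparse-list zero    _   = [] , refl , []
  sparse-list (suc k) k<R with sparse-list k (<⇒≤ k<R)
  ... | us , refl , sparse with ∑-average T cost (suc (q ^ length es)) average
    where
    cost : Vec (Fin s) v → ℕ
    cost t = 2 * ∑ us (λ u → penalty q (shared es t u))
    open ≤-Reasoning
    lengthT : length T ≡ s ^ v
    lengthT = trans (length-vecs (allFin s) v) (cong (_^ v) (length-allFin s))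
    lemma : ∀ a b c → a * (b * c) ≡ b * (a * c)
    lemma = solve-∀
    K*∑cost : K * ∑ T cost ≤ K * (q ^ length es * s ^ v)
    K*∑cost = begin
      K * ∑ T cost
        ≡⟨ cong (K *_) (trans (∑-*ˡ T 2 _) (cong (2 *_) (∑-swap T us (λ t u → penalty q (shared es t u))))) ⟩
      K * (2 * ∑ us (λ u → ∑ T (λ t → penalty q (shared es t u))))
        ≡⟨ lemma K 2 _ ⟩
      2 * (K * ∑ us (λ u → ∑ T (λ t → penalty q (shared es t u))))
        ≡⟨ cong (2 *_) (∑-*ˡ us K _) ⟨
      2 * ∑ us (λ u → K * ∑ T (λ t → penalty q (shared es t u)))
        ≤⟨ *-monoʳ-≤ 2 (∑-mono us penalty-average) ⟩
      2 * ∑ us (λ _ → (2 * s) ^ v)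
        ≡⟨ cong (2 *_) (∑-const us _) ⟩
      2 * (length us * (2 * s) ^ v)
        ≤⟨ *-monoʳ-≤ 2 (*-monoˡ-≤ ((2 * s) ^ v) (<⇒≤ k<R)) ⟩
      2 * (R * (2 * s) ^ v)
        ≡⟨ cong (λ z → 2 * (R * z)) (^-distribʳ-* 2 s v) ⟩
      2 * (R * (2 ^ v * s ^ v))
        ≡⟨ trans (sym (*-assoc 2 R _)) (sym (*-assoc (2 * R) _ _)) ⟩
      2 * R * 2 ^ v * s ^ v
        ≤⟨ *-monoˡ-≤ (s ^ v) K-large ⟩
      K * q ^ length es * s ^ v
        ≡⟨ *-assoc K _ _ ⟩
      K * (q ^ length es * s ^ v) ∎
    average : ∑ T cost < length T * suc (q ^ length es)
    average = begin-strict
      ∑ T cost                      ≤⟨ *-cancelˡ-≤ K K*∑cost ⟩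
      q ^ length es * s ^ v         <⟨ *-monoˡ-< (s ^ v) {{m^n≢0 s v}} (n<1+n (q ^ length es)) ⟩
      suc (q ^ length es) * s ^ v   ≡⟨ *-comm (suc (q ^ length es)) (s ^ v) ⟩
      s ^ v * suc (q ^ length es)   ≡⟨ cong (_* suc (q ^ length es)) lengthT ⟨
      length T * suc (q ^ length es) ∎
  ...   | t , s≤s cost≤ = t ∷ us , refl , cost≤ ∷ sparse

-- Sorting the ends makes the code symmetric, so that a word of length `n * n` colours unordered
-- pairs.
pairIndex : ∀ {n} → Fin n → Fin n → Fin (n * n)
pairIndex x y with toℕ x ≤? toℕ y
... | yes _ = combine x y
... | no  _ = combine y x

pairIndex-comm : ∀ {n} (x y : Fin n) → pairIndex x y ≡ pairIndex y x
pairIndex-comm x y with toℕ x ≤? toℕ y | toℕ y ≤? toℕ x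
... | yes x≤y | no  _   = refl
... | no  _   | yes _   = refl
... | no  x≰y | no  y≰x = contradiction (<⇒≤ (≰⇒> x≰y)) y≰x
... | yes x≤y | yes y≤x with toℕ-injective (≤-antisym x≤y y≤x)
...   | refl = refl

pairIndex-injective : ∀ {n} (x y x′ y′ : Fin n) → pairIndex x y ≡ pairIndex x′ y′ →
                      (x ≡ x′ × y ≡ y′) ⊎ (x ≡ y′ × y ≡ x′)
pairIndex-injective x y x′ y′ eq with toℕ x ≤? toℕ y | toℕ x′ ≤? toℕ y′
... | yes _ | yes _ = inj₁ (combine-injective x y x′ y′ eq)
... | yes _ | no  _ = inj₂ (combine-injective x y y′ x′ eq)
... | no  _ | yes _ = let (p , r) = combine-injective y x x′ y′ eq in inj₂ (r , p)
... | no  _ | no  _ = let (p , r) = combine-injective y x y′ x′ eq in inj₁ (r , p)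

∈-agree : ∀ {s v} {t u : Vec (Fin s) v} x → lookup t x ≡ lookup u x → x ∈ agree t u
∈-agree {t = t} {u} x eq = lookup⇒[]= x (agree t u)
  (trans (lookup-zipWith _ x t u) (dec-true (lookup t x ≟ lookup u x) eq))

record Ends {v} (d : Subset v) (a b : Fin v) : Set where
  field
    a∈   : a ∈ d
    b∈   : b ∈ d
    only : ∀ {x} → x ∈ d → x ≡ a ⊎ x ≡ b
open Ends

-- `S` is read as `v` rows of length `s`, one row for each vertex of `F`; the tuple `t` selects one
-- entry in each row, a transversal.
cell : ∀ {n s v} → Vec (Fin n) (v * s) → Vec (Fin s) v → Fin v → Fin n
cell S t a = lookup S (combine a (lookup t a))

cell-injective : ∀ {n s v} (S : Vec (Fin n) (v * s)) → Injective _≡_ _≡_ (lookup S) →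
  ∀ {t u : Vec (Fin s) v} a b → cell S t a ≡ cell S u b → a ≡ b × lookup t a ≡ lookup u b
cell-injective S S-inj {t} {u} a b eq = combine-injective a (lookup t a) b (lookup u b) (S-inj eq)

injective? : ∀ {n k} (S : Vec (Fin n) k) → Dec (Injective _≡_ _≡_ (lookup S))
injective? S = map′ (λ h {x} {y} → h x y) (λ h x y → h {x} {y})
  (all? λ x → all? λ y → (lookup S x ≟ lookup S y) →-dec (x ≟ y))

-- Gives weight 0 to arrays with repeated entries, so that the union bound can run over all words of
-- length `v * s`.
guard : {P : Set} → Dec P → ℕ → ℕ
guard (yes _) x = x
guard (no  _) x = 0

guard-yes : ∀ {P : Set} (P? : Dec P) → P → ∀ x → guard P? x ≡ x
guard-yes (yes _) p x = refl
guard-yes (no ¬p) p x = contradiction p ¬p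

module _ {v : ℕ} (es : List (Subset v)) (es! : Unique es) (end₁ end₂ : Subset v → Fin v)
  (ends : ∀ {d} → d ∈ₗ es → Ends d (end₁ d) (end₂ d))
  where

  edgeCell : ∀ {n s} → Vec (Fin n) (v * s) → Vec (Fin s) v → Subset v → Fin (n * n)
  edgeCell S t d = pairIndex (cell S t (end₁ d)) (cell S t (end₂ d))

  -- A vertex of an injective array determines its row and its place in the row. Equal pairs thus
  -- occupy the same two rows, which gives the edge, at the same places, which gives the agreement
  -- of the tuples. The two cases are the two orders of the ends.
  edgeCell-injective : ∀ {n s} (S : Vec (Fin n) (v * s)) → Injective _≡_ _≡_ (lookup S) →
    ∀ {t u : Vec (Fin s) v} {d d′} → d ∈ₗ es → d′ ∈ₗ es → edgeCell S t d ≡ edgeCell S u d′ →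
    d ≡ d′ × d ⊆ agree t u
  edgeCell-injective S S-inj {t} {u} {d} {d′} d∈ d′∈ eq
    with pairIndex-injective (cell S t (end₁ d)) (cell S t (end₂ d)) (cell S u (end₁ d′)) (cell S u (end₂ d′)) eq
  ... | inj₁ (eq₁ , eq₂) with cell-injective S S-inj {t} {u} _ _ eq₁ | cell-injective S S-inj {t} {u} _ _ eq₂
  ...   | p , tp | r , tr = ⊆-antisym
            (λ x∈ → [ (λ where refl → subst (_∈ d′) (sym p) (a∈ (ends d′∈)))
                    , (λ where refl → subst (_∈ d′) (sym r) (b∈ (ends d′∈))) ]′ (only (ends d∈) x∈))
            (λ x∈ → [ (λ where refl → subst (_∈ d) p (a∈ (ends d∈)))
                    , (λ where refl → subst (_∈ d) r (b∈ (ends d∈))) ]′ (only (ends d′∈) x∈))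
          , λ x∈ → [ (λ where refl → ∈-agree _ (trans tp (cong (lookup u) (sym p))))
                   , (λ where refl → ∈-agree _ (trans tr (cong (lookup u) (sym r)))) ]′ (only (ends d∈) x∈)
  edgeCell-injective S S-inj {t} {u} {d} {d′} d∈ d′∈ eq
      | inj₂ (eq₁ , eq₂) with cell-injective S S-inj {t} {u} _ _ eq₁ | cell-injective S S-inj {t} {u} _ _ eq₂
  ...   | p , tp | r , tr = ⊆-antisym
            (λ x∈ → [ (λ where refl → subst (_∈ d′) (sym p) (b∈ (ends d′∈)))
                    , (λ where refl → subst (_∈ d′) (sym r) (a∈ (ends d′∈))) ]′ (only (ends d∈) x∈))
            (λ x∈ → [ (λ where refl → subst (_∈ d) r (b∈ (ends d∈)))
                    , (λ where refl → subst (_∈ d) p (a∈ (ends d∈))) ]′ (only (ends d′∈) x∈))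
          , λ x∈ → [ (λ where refl → ∈-agree _ (trans tp (cong (lookup u) (sym p))))
                   , (λ where refl → ∈-agree _ (trans tr (cong (lookup u) (sym r)))) ]′ (only (ends d∈) x∈)

  -- Sparsity concerns index tuples only, so one family `us` serves all arrays. With `suc X * Z`
  -- tuples, `none-decay` and `power-gap` bound the failure of one array in one colour by 1 / 2 ^ Z;
  -- the last hypothesis is the union bound.
  colouring : ∀ {n s q Z X} .{{_ : NonZero q}} (us : List (Vec (Fin s) v)) → Sparse q es us →
    2 * q ^ length es ≡ suc X → length us ≡ suc X * Z → n ^ (v * s) * q < 2 ^ Z →
    ∃ λ (χ : Vec (Fin q) (n * n)) → ∀ i (S : Vec (Fin n) (v * s)) → Injective _≡_ _≡_ (lookup S) →
    ∃ λ (t : Vec (Fin s) v) → ∀ {d} → d ∈ₗ es → lookup χ (edgeCell S t d) ≡ i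
  colouring {n} {s} {q} {Z} {X} us sparse 2Q≡ len bound with ∑-average Ω total 1 small
    where
    Ω = vecs (allFin q) (n * n)
    Ss = vecs (allFin n) (v * s)
    open ≤-Reasoning
    bad : Vec (Fin n) (v * s) → Fin q → Vec (Fin q) (n * n) → ℕ
    bad S i ω = guard (injective? S) (avoid i es (edgeCell S) us ω)
    total : Vec (Fin q) (n * n) → ℕ
    total ω = ∑ Ss λ S → ∑ (allFin q) λ i → bad S i ω
    bad-bound : ∀ S i (S? : Dec (Injective _≡_ _≡_ (lookup S))) →
      2 ^ Z * ∑ Ω (λ ω → guard S? (avoid i es (edgeCell S) us ω)) ≤ q ^ (n * n)
    bad-bound S i (no  _)     = ≤-trans (≤-reflexive (trans (cong (2 ^ Z *_) (trans (∑-const Ω 0) (*-zeroʳ (length Ω)))) (*-zeroʳ (2 ^ Z)))) z≤n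
    bad-bound S i (yes S-inj) = *-cancelˡ-≤ (suc X ^ (suc X * Z)) {{m^n≢0 (suc X) (suc X * Z)}} (begin
      suc X ^ (suc X * Z) * (2 ^ Z * mass)  ≡⟨ lemma (suc X ^ (suc X * Z)) (2 ^ Z) mass ⟩
      2 ^ Z * (suc X ^ (suc X * Z) * mass)    ≤⟨ *-monoʳ-≤ (2 ^ Z) (subst (λ k → suc X ^ k * mass ≤ X ^ k * q ^ (n * n)) len (J.none-decay 2Q≡ sparse)) ⟩
      2 ^ Z * (X ^ (suc X * Z) * q ^ (n * n))  ≡⟨ *-assoc (2 ^ Z) _ _ ⟨
      2 ^ Z * X ^ (suc X * Z) * q ^ (n * n)    ≤⟨ *-monoˡ-≤ (q ^ (n * n)) (power-gap X Z) ⟩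
      suc X ^ (suc X * Z) * q ^ (n * n)    ∎)
      where
      module J = Janson i es es! (edgeCell S) (edgeCell-injective S S-inj)
      mass = ∑ Ω (avoid i es (edgeCell S) us)
      lemma : ∀ a b c → a * (b * c) ≡ b * (a * c)
      lemma = solve-∀
    lengthΩ : length Ω ≡ q ^ (n * n)
    lengthΩ = trans (length-vecs (allFin q) (n * n)) (cong (_^ (n * n)) (length-allFin q))
    small : ∑ Ω total < length Ω * 1
    small = *-cancelˡ-< (2 ^ Z) _ _ (begin-strict
      2 ^ Z * ∑ Ω total
        ≡⟨ cong (2 ^ Z *_) (trans (∑-swap Ω Ss _) (∑-cong Ss λ S → ∑-swap Ω (allFin q) (λ ω i → bad S i ω))) ⟩
      2 ^ Z * ∑ Ss (λ S → ∑ (allFin q) λ i → ∑ Ω (bad S i))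
        ≡⟨ trans (sym (∑-*ˡ Ss (2 ^ Z) _)) (∑-cong Ss λ S → sym (∑-*ˡ (allFin q) (2 ^ Z) _)) ⟩
      ∑ Ss (λ S → ∑ (allFin q) λ i → 2 ^ Z * ∑ Ω (bad S i))
        ≤⟨ ∑-mono Ss (λ S → ∑-mono (allFin q) λ i → bad-bound S i (injective? S)) ⟩
      ∑ Ss (λ S → ∑ (allFin q) λ i → q ^ (n * n))
        ≡⟨ trans (∑-cong Ss λ S → ∑-const (allFin q) _) (∑-const Ss _) ⟩
      length Ss * (length (allFin q) * q ^ (n * n))
        ≡⟨ cong₂ (λ a b → a * (b * q ^ (n * n))) (trans (length-vecs (allFin n) (v * s)) (cong (_^ (v * s)) (length-allFin n))) (length-allFin q) ⟩
      n ^ (v * s) * (q * q ^ (n * n))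
        ≡⟨ *-assoc (n ^ (v * s)) q _ ⟨
      n ^ (v * s) * q * q ^ (n * n)
        <⟨ *-monoˡ-< (q ^ (n * n)) {{m^n≢0 q (n * n)}} bound ⟩
      2 ^ Z * q ^ (n * n)
        ≡⟨ cong (2 ^ Z *_) (trans (sym lengthΩ) (sym (*-identityʳ _))) ⟩
      2 ^ Z * (length Ω * 1) ∎)
  ... | χ , s≤s total≤0 = χ , λ i S S-inj →
          Janson.none≡0 i es es! (edgeCell S) (edgeCell-injective S S-inj) us χ (avoid≡0 i S S-inj)
    where
    avoid≡0 : ∀ i S → Injective _≡_ _≡_ (lookup S) → avoid i es (edgeCell S) us χ ≡ 0
    avoid≡0 i S S-inj = n≤0⇒n≡0 (≤-trans (≤-reflexive (sym bad≡)) (≤-trans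
      (≤-trans (∑-∈ (bad S) (∈-allFin i)) (∑-∈ (λ S → ∑ (allFin q) (bad S)) (∈-vecs ∈-allFin S))) total≤0))
      where
      bad : Vec (Fin n) (v * s) → Fin q → ℕ
      bad S i = guard (injective? S) (avoid i es (edgeCell S) us χ)
      bad≡ : bad S i ≡ avoid i es (edgeCell S) us χ
      bad≡ = guard-yes (injective? S) S-inj _

-- The hypergraph H

does⇒ : ∀ {P : Set} (P? : Dec P) → does P? ≡ true → P
does⇒ (yes p) _ = p

enum : ∀ {n} (p : Subset n) → Fin ∣ p ∣ → Fin n
enum (inside ∷ p)  zero    = zero
enum (inside ∷ p)  (suc k) = suc (enum p k)
enum (outside ∷ p) k       = suc (enum p k)

enum-∈ : ∀ {n} (p : Subset n) k → enum p k ∈ p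
enum-∈ (inside ∷ p)  zero    = here
enum-∈ (inside ∷ p)  (suc k) = there (enum-∈ p k)
enum-∈ (outside ∷ p) k       = there (enum-∈ p k)

enum-injective : ∀ {n} (p : Subset n) {k l} → enum p k ≡ enum p l → k ≡ l
enum-injective (inside ∷ p)  {zero}  {zero}  eq = refl
enum-injective (inside ∷ p)  {suc k} {suc l} eq = cong suc (enum-injective p (suc-injective eq))
enum-injective (outside ∷ p) eq                 = enum-injective p (suc-injective eq)

enum-surjective : ∀ {n} (p : Subset n) {x} → x ∈ p → ∃ λ k → enum p k ≡ x
enum-surjective (inside ∷ p)  here       = zero , refl
enum-surjective (inside ∷ p)  (there x∈) = let (k , eq) = enum-surjective p x∈ in suc k , cong suc eq
enum-surjective (outside ∷ p) (there x∈) = let (k , eq) = enum-surjective p x∈ in k , cong suc eq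

two-elements : ∀ {n} (p : Subset n) → 2 ≤ ∣ p ∣ → ∃ λ x → ∃ λ y → x ≢ y × x ∈ p × y ∈ p
two-elements p 2≤ = enum p (inject≤ zero 2≤) , enum p (inject≤ (suc zero) 2≤) ,
  (λ eq → case inject≤-injective 2≤ 2≤ zero (suc zero) (enum-injective p eq) of λ ()) ,
  enum-∈ p _ , enum-∈ p _

∈-update⁺ : ∀ {n} (p : Subset n) k → k ∈ p [ k ]≔ inside
∈-update⁺ (b ∷ p) zero    = here
∈-update⁺ (b ∷ p) (suc k) = there (∈-update⁺ p k)

∈-update⁺′ : ∀ {n} (p : Subset n) k {x} → x ∈ p → x ∈ p [ k ]≔ inside
∈-update⁺′ (b ∷ p) zero    here       = here
∈-update⁺′ (b ∷ p) zero    (there x∈) = there x∈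
∈-update⁺′ (b ∷ p) (suc k) here       = here
∈-update⁺′ (b ∷ p) (suc k) (there x∈) = there (∈-update⁺′ p k x∈)

∈-update⁻ : ∀ {n} (p : Subset n) k {x} → x ∈ p [ k ]≔ inside → x ≡ k ⊎ x ∈ p
∈-update⁻ (b ∷ p) zero    here       = inj₁ refl
∈-update⁻ (b ∷ p) zero    (there x∈) = inj₂ (there x∈)
∈-update⁻ (b ∷ p) (suc k) here       = inj₂ here
∈-update⁻ (b ∷ p) (suc k) (there x∈) = map-⊎ (cong suc) there (∈-update⁻ p k x∈)

∣update∣ : ∀ {n} (p : Subset n) k → k ∉ p → ∣ p [ k ]≔ inside ∣ ≡ suc ∣ p ∣
∣update∣ (inside ∷ p)  zero    k∉ = contradiction here k∉
∣update∣ (outside ∷ p) zero    k∉ = refl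
∣update∣ (inside ∷ p)  (suc k) k∉ = cong suc (∣update∣ p k (k∉ ∘ there))
∣update∣ (outside ∷ p) (suc k) k∉ = ∣update∣ p k (k∉ ∘ there)

image : ∀ {a b} → (Fin a → Fin b) → Subset a → Subset b
image φ []            = ⊥
image φ (inside ∷ f)  = image (φ ∘ suc) f [ φ zero ]≔ inside
image φ (outside ∷ f) = image (φ ∘ suc) f

∈-image⁺ : ∀ {a b} (φ : Fin a → Fin b) f {x} → x ∈ f → φ x ∈ image φ f
∈-image⁺ φ (inside ∷ f)  here       = ∈-update⁺ (image (φ ∘ suc) f) (φ zero)
∈-image⁺ φ (inside ∷ f)  (there x∈) = ∈-update⁺′ (image (φ ∘ suc) f) (φ zero) (∈-image⁺ (φ ∘ suc) f x∈)
∈-image⁺ φ (outside ∷ f) (there x∈) = ∈-image⁺ (φ ∘ suc) f x∈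

∈-image⁻ : ∀ {a b} (φ : Fin a → Fin b) f {y} → y ∈ image φ f → ∃ λ x → x ∈ f × φ x ≡ y
∈-image⁻ φ []            y∈ = contradiction y∈ ∉⊥
∈-image⁻ φ (inside ∷ f)  y∈ with ∈-update⁻ (image (φ ∘ suc) f) (φ zero) y∈
... | inj₁ refl = zero , here , refl
... | inj₂ y∈′  = let (x , x∈ , eq) = ∈-image⁻ (φ ∘ suc) f y∈′ in suc x , there x∈ , eq
∈-image⁻ φ (outside ∷ f) y∈ = let (x , x∈ , eq) = ∈-image⁻ (φ ∘ suc) f y∈ in suc x , there x∈ , eq

∣image∣ : ∀ {a b} (φ : Fin a → Fin b) → Injective _≡_ _≡_ φ → ∀ f → ∣ image φ f ∣ ≡ ∣ f ∣
∣image∣ {b = b} φ φ-inj []    = ∣⊥∣≡0 b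
∣image∣ φ φ-inj (outside ∷ f) = ∣image∣ (φ ∘ suc) (suc-injective ∘ φ-inj) f
∣image∣ φ φ-inj (inside ∷ f)  = trans
  (∣update∣ (image (φ ∘ suc) f) (φ zero) λ 0∈ →
    let (x , _ , eq) = ∈-image⁻ (φ ∘ suc) f 0∈ in case φ-inj eq of λ ())
  (cong suc (∣image∣ (φ ∘ suc) (suc-injective ∘ φ-inj) f))

mapsOnto? : ∀ {a b} (φ : Fin a → Fin b) e f → Dec (MapsOnto φ e f)
mapsOnto? φ e f = all? λ y →
  (y ∈? f →-dec preimage? y) ×-dec (preimage? y →-dec y ∈? f)
  where
  preimage? : ∀ y → Dec (∃ λ x → x ∈ e × φ x ≡ y)
  preimage? y = any? λ x → (x ∈? e) ×-dec (φ x ≟ y)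

mapsOnto-∘ : ∀ {a b c} {φ : Fin a → Fin b} {ψ : Fin b → Fin c} {e f g} →
             MapsOnto φ e f → MapsOnto ψ f g → MapsOnto (ψ ∘ φ) e g
mapsOnto-∘ {φ = φ} {ψ} φ-onto ψ-onto z =
  (λ z∈ → let (y , y∈ , ψy≡z) = proj₁ (ψ-onto z) z∈
              (x , x∈ , φx≡y) = proj₁ (φ-onto y) y∈
          in x , x∈ , trans (cong ψ φx≡y) ψy≡z) ,
  λ (x , x∈ , eq) → proj₂ (ψ-onto z) (φ x , proj₂ (φ-onto (φ x)) (x , x∈ , refl) , eq)

module Construction {r v n q : ℕ} (F : RGraph r v)
  (Ψ : Vec (Vec (Fin v) n) q) (χ : Vec (Fin q) (n * n)) where

  ψ : Fin q → Fin n → Fin v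
  ψ i x = lookup (lookup Ψ i) x

  Mono : Fin q → Subset n → Set
  Mono i e = ∀ x y → x ∈ e → y ∈ e → x ≢ y → lookup χ (pairIndex x y) ≡ i

  Coloured : Fin q → Subset n → Set
  Coloured i e = Mono i e × ∃ λ f → IsEdge F f × MapsOnto (ψ i) e f

  coloured? : ∀ i e → Dec (Coloured i e)
  coloured? i e =
    (all? λ x → all? λ y → (x ∈? e) →-dec ((y ∈? e) →-dec (¬? (x ≟ y) →-dec (lookup χ (pairIndex x y) ≟ i))))
    ×-dec anySubset? (λ f → (E F f ≟ᵇ true) ×-dec mapsOnto? (ψ i) e f)

  isEdge? : ∀ e → Dec (∣ e ∣ ≡ r × ∃ λ i → Coloured i e)
  isEdge? e = (∣ e ∣ ≟ℕ r) ×-dec any? (λ i → coloured? i e)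

  H : RGraph r n
  H = record
    { E       = λ e → does (isEdge? e)
    ; uniform = λ e e∈H → proj₁ (does⇒ (isEdge? e) e∈H)
    }

  -- Two edges of H sharing a pair have the same colour, so a 2-tightly connected
  -- subgraph lives in one colour i, on which ψ i is a homomorphism to F.
  H-free : Fin q → ∀ {vG} (G : RGraph r vG) → TightlyConnected 2 G → ¬ Homomorphic G F → Free G H
  H-free i₀ {vG} G (es , _ , es⊆ , ⊆es , tight) no-hom (φ , φ-inj , _ , φ-edge) =
    no-hom (hom es es⊆ ⊆es tight)
    where
    Lifted : Fin q → Subset vG → Set
    Lifted i e = (∀ x y → x ∈ e → y ∈ e → x ≢ y → lookup χ (pairIndex (φ x) (φ y)) ≡ i) ×
                 ∃ λ f → IsEdge F f × MapsOnto (ψ i ∘ φ) e f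
    lift : ∀ e → IsEdge G e → ∃ λ i → Lifted i e
    lift e e∈G with φ-edge e e∈G
    ... | f , f∈H , onto with does⇒ (isEdge? f) f∈H
    ...   | _ , i , mono , g , g∈F , onto′ = i ,
            (λ x y x∈ y∈ x≢y → mono (φ x) (φ y) (proj₂ (onto (φ x)) (x , x∈ , refl))
              (proj₂ (onto (φ y)) (y , y∈ , refl)) (x≢y ∘ φ-inj)) ,
            g , g∈F , mapsOnto-∘ {φ = φ} {ψ i} onto onto′
    hom : ∀ es → (∀ e → e ∈ₗ es → IsEdge G e) → (∀ e → IsEdge G e → e ∈ₗ es) →
          (∀ k → 1 ≤ toℕ k → ∃ λ j → toℕ j < toℕ k × 2 ≤ ∣ lookupₗ es k ∩ lookupₗ es j ∣) →
          Homomorphic G F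
    -- Without edges any map of the vertices is a homomorphism; `i₀` supplies one.
    hom []         es⊆ ⊆es tight = ψ i₀ ∘ φ , λ e e∈G → case ⊆es e e∈G of λ ()
    hom (e₀ ∷ es′) es⊆ ⊆es tight = ψ i ∘ φ , λ e e∈G →
      proj₂ (subst (Lifted i) (sym (lookup-index (⊆es e e∈G)))
        (all-lifted (suc (toℕ (Any.index (⊆es e e∈G)))) (Any.index (⊆es e e∈G)) ≤-refl))
      where
      i = proj₁ (lift e₀ (es⊆ e₀ (here refl)))
      -- The bound `b` allows the induction to reach an arbitrary earlier edge, not only the
      -- preceding one.
      all-lifted : ∀ b k → toℕ k < b → Lifted i (lookupₗ (e₀ ∷ es′) k)
      all-lifted (suc b) zero    _        = proj₂ (lift e₀ (es⊆ e₀ (here refl)))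
      all-lifted (suc b) (suc k) (s≤s k<) with tight (suc k) (s≤s z≤n)
      ... | j , j< , 2≤ with two-elements _ 2≤ | all-lifted b j (<-≤-trans j< k<)
                           | lift _ (es⊆ _ (∈-lookup {xs = e₀ ∷ es′} (suc k)))
      ...   | x , y , x≢y , x∈ , y∈ | mono , _ | i′ , mono′ , rest
              with x∈p∩q⁻ (lookupₗ (e₀ ∷ es′) (suc k)) _ x∈ | x∈p∩q⁻ (lookupₗ (e₀ ∷ es′) (suc k)) _ y∈
      ...     | x∈k , x∈j | y∈k , y∈j =
                subst (λ c → Lifted c (lookupₗ es′ k))
                  (trans (sym (mono′ x y x∈k y∈k x≢y)) (mono x y x∈j y∈j x≢y)) (mono′ , rest)

-- Copies of F in H

module _ {r v n q s : ℕ} (F : RGraph r v) (Ψ : Vec (Vec (Fin v) n) q) (χ : Vec (Fin q) (n * n))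
  (i : Fin q) (S : Subset n) (large : ∀ a → s ≤ ∣ S ∩ fibre (lookup Ψ i) a ∣)
  where

  open Construction F Ψ χ

  transversal : Fin v → Fin s → Fin n
  transversal a x = enum (S ∩ fibre (lookup Ψ i) a) (inject≤ x (large a))

  transversal-∈ : ∀ a x → transversal a x ∈ S × ψ i (transversal a x) ≡ a
  transversal-∈ a x with x∈p∩q⁻ S _ (enum-∈ (S ∩ fibre (lookup Ψ i) a) (inject≤ x (large a)))
  ... | ∈S , ∈fibre = ∈S , does⇒ (ψ i (transversal a x) ≟ a)
          (trans (sym (lookup-map (transversal a x) _ (lookup Ψ i))) ([]=⇒lookup ∈fibre))

  array : Vec (Fin n) (v * s)
  array = tabulate (uncurry transversal ∘ remQuot s)

  lookup-array : ∀ a x → lookup array (combine a x) ≡ transversal a x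
  lookup-array a x = trans (lookup∘tabulate _ (combine a x)) (cong (uncurry transversal) (remQuot-combine a x))

  array-injective : Injective _≡_ _≡_ (lookup array)
  array-injective {k} {l} eq = begin
    k                            ≡⟨ combine-remQuot {v} s k ⟨
    uncurry combine (remQuot {v} s k) ≡⟨ cong (uncurry combine) (transversal-injective _ _ (trans (sym (lookup∘tabulate _ k)) (trans eq (lookup∘tabulate _ l)))) ⟩
    uncurry combine (remQuot {v} s l) ≡⟨ combine-remQuot {v} s l ⟩
    l                            ∎
    where
    open ≡-Reasoning
    transversal-injective : ∀ p p′ → uncurry transversal p ≡ uncurry transversal p′ → p ≡ p′
    transversal-injective (a , x) (b , y) eq
      with trans (sym (proj₂ (transversal-∈ a x))) (trans (cong (ψ i) eq) (proj₂ (transversal-∈ b y)))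
    ... | refl = cong (a ,_) (inject≤-injective (large a) (large a) x y (enum-injective (S ∩ fibre (lookup Ψ i) a) eq))

  -- The map `cell array t` is a section of `ψ i`. Hence it is injective, and `ψ i` sends the image
  -- of an edge `f` back onto `f`; only the colour has to come from `mono`.
  copy : (t : Vec (Fin s) v) →
    (∀ a b → a ≢ b → (∃ λ f → IsEdge F f × a ∈ f × b ∈ f) →
      lookup χ (pairIndex (cell array t a) (cell array t b)) ≡ i) →
    CopyIn F H S
  copy t mono = φ , φ-injective , (λ a → proj₁ (φ-∈ a)) , λ f f∈F →
    image φ f ,
    dec-true (isEdge? (image φ f))
      ( trans (∣image∣ φ φ-injective f) (uniform F f f∈F)
      , i
      , (λ x y x∈ y∈ x≢y → image-mono f f∈F (∈-image⁻ φ f x∈) (∈-image⁻ φ f y∈) x≢y)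
      , f , f∈F , λ a →
          (λ a∈ → φ a , ∈-image⁺ φ f a∈ , proj₂ (φ-∈ a))
        , λ (x , x∈ , eq) → let (b , b∈ , φb≡x) = ∈-image⁻ φ f x∈
                            in subst (_∈ f) (trans (sym (proj₂ (φ-∈ b))) (trans (cong (ψ i) φb≡x) eq)) b∈) ,
    λ y → ∈-image⁻ φ f , λ (x , x∈ , eq) → subst (_∈ image φ f) eq (∈-image⁺ φ f x∈)
    where
    φ : Fin v → Fin n
    φ = cell array t
    φ-∈ : ∀ a → φ a ∈ S × ψ i (φ a) ≡ a
    φ-∈ a rewrite lookup-array a (lookup t a) = transversal-∈ a (lookup t a)
    φ-injective : Injective _≡_ _≡_ φ
    φ-injective {a} {b} eq = trans (sym (proj₂ (φ-∈ a))) (trans (cong (ψ i) eq) (proj₂ (φ-∈ b)))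
    image-mono : ∀ f → IsEdge F f → ∀ {x y} → (∃ λ a → a ∈ f × φ a ≡ x) → (∃ λ b → b ∈ f × φ b ≡ y) →
                 x ≢ y → lookup χ (pairIndex x y) ≡ i
    image-mono f f∈F (a , a∈ , refl) (b , b∈ , refl) x≢y =
      mono a b (x≢y ∘ cong φ) (f , f∈F , a∈ , b∈)

-- The 2-shadow of `F` as a duplicate-free list of pairs with chosen ends

∈-allSubsets : ∀ {n} (p : Subset n) → p ∈ₗ allSubsets n
∈-allSubsets []            = here refl
∈-allSubsets (inside ∷ p)  = ∈-++⁺ˡ (∈-map⁺ (inside ∷_) (∈-allSubsets p))
∈-allSubsets {suc n} (outside ∷ p) = ∈-++⁺ʳ (map (inside ∷_) (allSubsets n)) (∈-map⁺ (outside ∷_) (∈-allSubsets p))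

allSubsets! : ∀ n → Unique (allSubsets n)
allSubsets! zero    = [] ∷ []
allSubsets! (suc n) = Unique.++⁺
  (Unique.map⁺ ∷-injectiveʳ (allSubsets! n)) (Unique.map⁺ ∷-injectiveʳ (allSubsets! n))
  λ (p∈ , p∈′) → let (_ , _ , eq)  = ∈-map⁻ (inside ∷_) p∈
                     (_ , _ , eq′) = ∈-map⁻ (outside ∷_) p∈′
                 in case ∷-injectiveˡ (trans (sym eq) eq′) of λ ()

any-true : ∀ {A : Set} (p : A → Bool) {x xs} → x ∈ₗ xs → p x ≡ true → any p xs ≡ true
any-true p {xs = y ∷ xs} (here refl) px≡ rewrite px≡ = refl
any-true p {xs = y ∷ xs} (there x∈)  px≡ rewrite any-true p x∈ px≡ = ∨-zeroʳ (p y)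

⌊⌋-true : ∀ {P : Set} (P? : Dec P) → P → ⌊ P? ⌋ ≡ true
⌊⌋-true P? p = trans (isYes≗does P?) (dec-true P? p)

∧-true : ∀ {a b} → a ∧ b ≡ true → a ≡ true × b ≡ true
∧-true {true} eq = refl , eq

module _ {r v : ℕ} (F : RGraph r v) where

  shadowEdges : List (Subset v)
  shadowEdges = filter (λ d → E (shadow2 F) d ≟ᵇ true) (allSubsets v)

  shadowEdges! : Unique shadowEdges
  shadowEdges! = Unique.filter⁺ (λ d → E (shadow2 F) d ≟ᵇ true) (allSubsets! v)

  ∈-shadowEdges⁻ : ∀ {d} → d ∈ₗ shadowEdges → IsEdge (shadow2 F) d
  ∈-shadowEdges⁻ d∈ = proj₂ (∈-filter⁻ (λ d → E (shadow2 F) d ≟ᵇ true) {xs = allSubsets v} d∈)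

  ∈-shadowEdges⁺ : ∀ {d f} → ∣ d ∣ ≡ 2 → IsEdge F f → d ⊆ f → d ∈ₗ shadowEdges
  ∈-shadowEdges⁺ {d} {f} ∣d∣≡2 f∈F d⊆f =
    ∈-filter⁺ (λ d → E (shadow2 F) d ≟ᵇ true) (∈-allSubsets d) (cong₂ _∧_
      (Equivalence.to T-≡ (≡⇒≡ᵇ ∣ d ∣ 2 ∣d∣≡2))
      (any-true _ (∈-allSubsets f) (cong₂ _∧_ f∈F (⌊⌋-true (d ⊆? f) d⊆f))))

  -- Agreement sets of tuples are vertex sets, so maximality of `F*` is compared with induced
  -- subgraphs.
  induced : Subset v → Subgraph (shadow2 F)
  induced J = record
    { W   = J
    ; D   = λ d → E (shadow2 F) d ∧ ⌊ d ⊆? J ⌋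
    ; D⊆E = λ d eq → proj₁ (∧-true eq)
    ; D⊆W = λ d eq → does⇒ (d ⊆? J) (trans (sym (isYes≗does (d ⊆? J))) (proj₂ (∧-true {E (shadow2 F) d} eq)))
    }

  length-edgesIn : ∀ J → length (edgesIn shadowEdges J) ≡ eSub (induced J)
  length-edgesIn J = go (allSubsets v)
    where
    go : ∀ ds → length (edgesIn (filter (λ d → E (shadow2 F) d ≟ᵇ true) ds) J) ≡
                sum (map (λ d → if E (shadow2 F) d ∧ ⌊ d ⊆? J ⌋ then 1 else 0) ds)
    go []       = refl
    go (d ∷ ds) with E (shadow2 F) d
    ... | false = go ds
    ... | true with d ⊆? J
    ...   | yes _ = cong suc (go ds)
    ...   | no  _ = go ds

numEdges≥1 : ∀ {v} (D : Subset v → Bool) → 1 ≤ numEdges D → ∃ λ d → D d ≡ true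
numEdges≥1 {v} D = go (allSubsets v)
  where
  go : ∀ ds → 1 ≤ sum (map (λ d → if D d then 1 else 0) ds) → ∃ λ d → D d ≡ true
  go (d ∷ ds) 1≤ with D d in eq
  ... | true  = d , eq
  ... | false = go ds 1≤

-- Total, because `edgeCell` takes functions on all subsets; the default value is the reason for a
-- nonempty vertex set `suc w`.
ends : ∀ {w} → Subset (suc w) → Fin (suc w) × Fin (suc w)
ends d with 2 ≤? ∣ d ∣
... | yes 2≤ = enum d (inject≤ zero 2≤) , enum d (inject≤ (suc zero) 2≤)
... | no  _  = zero , zero

ends-spec : ∀ {w} (d : Subset (suc w)) → ∣ d ∣ ≡ 2 → Ends d (proj₁ (ends d)) (proj₂ (ends d))
ends-spec d ∣d∣≡2 with 2 ≤? ∣ d ∣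
... | no  2≰ = contradiction (≤-reflexive (sym ∣d∣≡2)) 2≰
... | yes 2≤ = record
  { a∈   = enum-∈ d _
  ; b∈   = enum-∈ d _
  ; only = λ x∈ → let (k , eq) = enum-surjective d x∈ in
      map-⊎ (λ k≡ → trans (sym eq) (cong (enum d) k≡)) (λ k≡ → trans (sym eq) (cong (enum d) k≡)) (two ∣d∣≡2 2≤ k)
  }
  where
  two : ∀ {m} → m ≡ 2 → (2≤ : 2 ≤ m) (k : Fin m) → k ≡ inject≤ zero 2≤ ⊎ k ≡ inject≤ (suc zero) 2≤
  two refl 2≤ zero       = inj₁ refl
  two refl 2≤ (suc zero) = inj₂ refl

pair : ∀ {n} → Fin n → Fin n → Subset n
pair a b = (⊥ [ b ]≔ inside) [ a ]≔ inside

∈-pair⁻ : ∀ {n} (a b : Fin n) {x} → x ∈ pair a b → x ≡ a ⊎ x ≡ b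
∈-pair⁻ a b x∈ with ∈-update⁻ (⊥ [ b ]≔ inside) a x∈
... | inj₁ x≡a = inj₁ x≡a
... | inj₂ x∈′ with ∈-update⁻ ⊥ b x∈′
...   | inj₁ x≡b = inj₂ x≡b
...   | inj₂ x∈⊥ = contradiction x∈⊥ ∉⊥

∣pair∣ : ∀ {n} {a b : Fin n} → a ≢ b → ∣ pair a b ∣ ≡ 2
∣pair∣ {n} {a} {b} a≢b = trans
  (∣update∣ (⊥ [ b ]≔ inside) a λ a∈ → [ a≢b , (λ a∈⊥ → ∉⊥ a∈⊥) ]′ (∈-update⁻ ⊥ b a∈))
  (cong suc (trans (∣update∣ ⊥ b ∉⊥) (cong suc (∣⊥∣≡0 n))))

pairIndex-ends : ∀ {v n} {d : Subset v} {a b a′ b′} (φ : Fin v → Fin n) → Ends d a′ b′ →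
                 a ≢ b → a ∈ d → b ∈ d → pairIndex (φ a) (φ b) ≡ pairIndex (φ a′) (φ b′)
pairIndex-ends {a = a} {b} φ end a≢b a∈ b∈ with Ends.only end a∈ | Ends.only end b∈
... | inj₁ refl | inj₁ refl = contradiction refl a≢b
... | inj₁ refl | inj₂ refl = refl
... | inj₂ refl | inj₁ refl = pairIndex-comm (φ a) (φ b)
... | inj₂ refl | inj₂ refl = contradiction refl a≢b

edge-cell-mono : ∀ {r w n q s} (F : RGraph r (suc w)) (χ : Vec (Fin q) (n * n)) (A : Vec (Fin n) (suc w * s))
  (t : Vec (Fin s) (suc w)) {i} →
  (∀ {d} → d ∈ₗ shadowEdges F →
     lookup χ (pairIndex (cell A t (proj₁ (ends d))) (cell A t (proj₂ (ends d)))) ≡ i) →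
  ∀ a b → a ≢ b → (∃ λ f → IsEdge F f × a ∈ f × b ∈ f) →
  lookup χ (pairIndex (cell A t a) (cell A t b)) ≡ i
edge-cell-mono F χ A t mono a b a≢b (f , f∈F , a∈ , b∈) =
  trans (cong (lookup χ) (pairIndex-ends (cell A t) (ends-spec (pair a b) (∣pair∣ a≢b)) a≢b
          (∈-update⁺ (⊥ [ b ]≔ inside) a) (∈-update⁺′ (⊥ [ b ]≔ inside) a (∈-update⁺ ⊥ b))))
        (mono (∈-shadowEdges⁺ F (∣pair∣ a≢b) f∈F λ x∈ →
          [ (λ where refl → a∈) , (λ where refl → b∈) ]′ (∈-pair⁻ a b x∈)))

-- Numerical estimates

n<2^n : ∀ n → n < 2 ^ n
n<2^n zero    = s≤s z≤n
n<2^n (suc n) = begin-strict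
  suc n          <⟨ s≤s (n<2^n n) ⟩
  suc (2 ^ n)    ≤⟨ +-monoˡ-≤ (2 ^ n) (m^n>0 2 n) ⟩
  2 ^ n + 2 ^ n  ≡⟨ cong (2 ^ n +_) (+-identityʳ (2 ^ n)) ⟨
  2 ^ suc n      ∎
  where open ≤-Reasoning

n<2^[1+log₂n] : ∀ n → n < 2 ^ suc ⌊log₂ n ⌋
n<2^[1+log₂n] n = ≰⇒> λ 2^≤n → <-irrefl refl
  (subst (_≤ ⌊log₂ n ⌋) (⌊log₂[2^n]⌋≡n (suc ⌊log₂ n ⌋)) (⌊log₂⌋-mono-≤ 2^≤n))

-- Per map, `m ≥ 8 * v * s` gains a factor `2 ^ (4 * s)` over the mean weight. One `2 ^ s` pays for
-- the `n ^ m` sets, as `q = 16 * v * ℓ` and `m ≤ 16 * v * s`; one for the `v` classes; one for the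
-- step from `2 ^ m` to `2 ^ d`. The fourth makes the inequality strict.
balanced-bound : ∀ w s d n ℓ → n ≤ 2 ^ ℓ → 1 ≤ ℓ → 1 ≤ s → suc w ≤ s →
  8 * suc w * s ≤ s + d → s + d ≤ 16 * suc w * s →
  n ^ (s + d) * (suc w * (1 + w * 2) ^ (s + d)) ^ (16 * suc w * ℓ) <
  (suc w ^ (s + d) * 2 ^ d) ^ (16 * suc w * ℓ)
balanced-bound w s d n ℓ n≤ 1≤ℓ 1≤s v≤s lo hi = *-cancelˡ-< ((2 ^ s) ^ q) _ _ (begin-strict
  (2 ^ s) ^ q * (n ^ m * (v * x ^ m) ^ q)
    ≡⟨ cong (λ z → (2 ^ s) ^ q * (n ^ m * z)) (^-distribʳ-* v (x ^ m) q) ⟩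
  (2 ^ s) ^ q * (n ^ m * (v ^ q * (x ^ m) ^ q))
    ≡⟨ lemma₁ ((2 ^ s) ^ q) (n ^ m) (v ^ q) ((x ^ m) ^ q) ⟩
  n ^ m * v ^ q * (2 ^ s) ^ q * (x ^ m) ^ q
    ≤⟨ *-monoˡ-≤ ((x ^ m) ^ q) (*-monoˡ-≤ ((2 ^ s) ^ q) (*-mono-≤ n^m≤ (^-monoˡ-≤ q v≤2^s))) ⟩
  (2 ^ s) ^ q * (2 ^ s) ^ q * (2 ^ s) ^ q * (x ^ m) ^ q
    ≡⟨ cong (_* (x ^ m) ^ q) (trans (cong (_* (2 ^ s) ^ q) (sym (^-distribʳ-* (2 ^ s) (2 ^ s) q))) (sym (^-distribʳ-* (2 ^ s * 2 ^ s) (2 ^ s) q))) ⟩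
  (2 ^ s * 2 ^ s * 2 ^ s) ^ q * (x ^ m) ^ q
    <⟨ *-monoˡ-< ((x ^ m) ^ q) (^-monoˡ-< q three<four) ⟩
  (2 ^ (4 * s)) ^ q * (x ^ m) ^ q
    ≡⟨ ^-distribʳ-* (2 ^ (4 * s)) (x ^ m) q ⟨
  (2 ^ (4 * s) * x ^ m) ^ q
    ≤⟨ ^-monoˡ-≤ q gap ⟩
  (suc x ^ m) ^ q
    ≡⟨ cong (_^ q) rhs ⟩
  (2 ^ s * (v ^ m * 2 ^ d)) ^ q
    ≡⟨ ^-distribʳ-* (2 ^ s) (v ^ m * 2 ^ d) q ⟩
  (2 ^ s) ^ q * (v ^ m * 2 ^ d) ^ q ∎)
  where
  open ≤-Reasoning
  v = suc w
  x = 1 + w * 2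
  m = s + d
  q = 16 * v * ℓ
  instance
    ℓ≢0 : NonZero ℓ
    ℓ≢0 = >-nonZero 1≤ℓ
    q≢0 : NonZero q
    q≢0 = m*n≢0 (16 * v) ℓ
    xmq≢0 : NonZero ((x ^ m) ^ q)
    xmq≢0 = m^n≢0 (x ^ m) q {{m^n≢0 x m}}
  lemma₁ : ∀ a b c d → a * (b * (c * d)) ≡ b * c * a * d
  lemma₁ = solve-∀
  v≤2^s : v ≤ 2 ^ s
  v≤2^s = ≤-trans v≤s (<⇒≤ (n<2^n s))
  n^m≤ : n ^ m ≤ (2 ^ s) ^ q
  n^m≤ = begin
    n ^ m                     ≤⟨ ^-monoˡ-≤ m n≤ ⟩
    (2 ^ ℓ) ^ m               ≡⟨ ^-*-assoc 2 ℓ m ⟩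
    2 ^ (ℓ * m)               ≤⟨ ^-monoʳ-≤ 2 (*-monoʳ-≤ ℓ hi) ⟩
    2 ^ (ℓ * (16 * v * s))    ≡⟨ cong (2 ^_) (lemma₂ ℓ (16 * v) s) ⟩
    2 ^ (s * q)               ≡⟨ ^-*-assoc 2 s q ⟨
    (2 ^ s) ^ q               ∎
    where
    lemma₂ : ∀ a b c → a * (b * c) ≡ c * (b * a)
    lemma₂ = solve-∀
  three<four : 2 ^ s * 2 ^ s * 2 ^ s < 2 ^ (4 * s)
  three<four = begin-strict
    2 ^ s * 2 ^ s * 2 ^ s  ≡⟨ cong (_* 2 ^ s) (^-distribˡ-+-* 2 s s) ⟨
    2 ^ (s + s) * 2 ^ s    ≡⟨ ^-distribˡ-+-* 2 (s + s) s ⟨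
    2 ^ (s + s + s)        <⟨ ^-monoʳ-< 2 (s≤s (s≤s z≤n)) (m<m+n (s + s + s) 1≤s) ⟩
    2 ^ (s + s + s + s)    ≡⟨ cong (2 ^_) (lemma₃ s) ⟩
    2 ^ (4 * s)            ∎
    where
    lemma₃ : ∀ s → s + s + s + s ≡ 4 * s
    lemma₃ = solve-∀
  gap : 2 ^ (4 * s) * x ^ m ≤ suc x ^ m
  -- `power-gap` is applied to the multiple `m₀` of `suc x`; the remaining `g` factors can only
  -- help.
  gap = subst (λ k → 2 ^ (4 * s) * x ^ k ≤ suc x ^ k) (m+[n∸m]≡n m₀≤m) (begin
    2 ^ (4 * s) * x ^ (m₀ + g)       ≡⟨ cong (2 ^ (4 * s) *_) (^-distribˡ-+-* x m₀ g) ⟩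
    2 ^ (4 * s) * (x ^ m₀ * x ^ g)   ≡⟨ *-assoc (2 ^ (4 * s)) _ _ ⟨
    2 ^ (4 * s) * x ^ m₀ * x ^ g     ≤⟨ *-mono-≤ (power-gap x (4 * s)) (^-monoˡ-≤ g (n≤1+n x)) ⟩
    suc x ^ m₀ * suc x ^ g           ≡⟨ ^-distribˡ-+-* (suc x) m₀ g ⟨
    suc x ^ (m₀ + g)                 ∎)
    where
    m₀ = suc x * (4 * s)
    g = m ∸ m₀
    lemma₄ : ∀ w s → suc (1 + w * 2) * (4 * s) ≡ 8 * suc w * s
    lemma₄ = solve-∀
    m₀≤m : m₀ ≤ m
    m₀≤m = ≤-trans (≤-reflexive (lemma₄ w s)) lo
  rhs : suc x ^ m ≡ 2 ^ s * (v ^ m * 2 ^ d)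
  rhs = begin-equality
    (v * 2) ^ m                 ≡⟨ ^-distribʳ-* v 2 m ⟩
    v ^ m * 2 ^ (s + d)         ≡⟨ cong (v ^ m *_) (^-distribˡ-+-* 2 s d) ⟩
    v ^ m * (2 ^ s * 2 ^ d)     ≡⟨ lemma₅ (v ^ m) (2 ^ s) (2 ^ d) ⟩
    2 ^ s * (v ^ m * 2 ^ d)     ∎
    where
    lemma₅ : ∀ a b c → a * (b * c) ≡ b * (a * c)
    lemma₅ = solve-∀

union-bound : ∀ n ℓ k q → n ≤ 2 ^ ℓ → n ^ k * q < 2 ^ (ℓ * k + q)
union-bound n ℓ k q n≤ = begin-strict
  n ^ k * q            ≤⟨ *-monoˡ-≤ q (≤-trans (^-monoˡ-≤ k n≤) (≤-reflexive (^-*-assoc 2 ℓ k))) ⟩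
  2 ^ (ℓ * k) * q      <⟨ *-monoʳ-< (2 ^ (ℓ * k)) {{m^n≢0 2 (ℓ * k)}} (n<2^n q) ⟩
  2 ^ (ℓ * k) * 2 ^ q  ≡⟨ ^-distribˡ-+-* 2 (ℓ * k) q ⟨
  2 ^ (ℓ * k + q)      ∎
  where open ≤-Reasoning

-- Collects `K = 2 ^ (2 + v) * Z` with `Z ≤ 4 * v * s * L`, and the `e`-th power of the coefficient
-- in `q ≤ 32 * v * L`.
densityConst : ℕ → ℕ → ℕ
densityConst v e = 2 ^ (4 + v) * v * (32 * v) ^ e

-- The union-bound exponent is of order `s * L`: its factor `s` lowers the power of `s` from `suc j`
-- to `j`, its factor `L` raises the power of `L` from `k` to `k + 1`.
density-bound : ∀ v e s L k j .{{_ : NonZero v}} → 1 ≤ L → 16 ≤ s → k ≤ e →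
  densityConst v e * L ^ (k + 1) ≤ s ^ j →
  2 ^ (2 + v) * (suc L * (v * s) + 16 * v * suc L) * (16 * v * suc L) ^ k ≤ s ^ suc j
density-bound v e s L k j 1≤L 16≤s k≤e dense = begin
  2 ^ (2 + v) * (suc L * (v * s) + 16 * v * suc L) * (16 * v * suc L) ^ k
    ≤⟨ *-mono-≤ (*-monoʳ-≤ (2 ^ (2 + v)) (+-mono-≤ (*-monoˡ-≤ (v * s) ℓ≤)
         (*-mono-≤ (*-monoˡ-≤ v 16≤s) ℓ≤))) (^-monoˡ-≤ k (*-monoʳ-≤ (16 * v) ℓ≤)) ⟩
  2 ^ (2 + v) * (2 * L * (v * s) + s * v * (2 * L)) * (16 * v * (2 * L)) ^ k
    ≡⟨ cong (2 ^ (2 + v) * (2 * L * (v * s) + s * v * (2 * L)) *_) (trans (cong (_^ k) (lemma₁ v L)) (^-distribʳ-* (32 * v) L k)) ⟩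
  2 ^ (2 + v) * (2 * L * (v * s) + s * v * (2 * L)) * ((32 * v) ^ k * L ^ k)
    ≡⟨ lemma₂ (2 ^ v) L v s ((32 * v) ^ k) (L ^ k) ⟩
  s * (2 ^ (4 + v) * v * (32 * v) ^ k * (L ^ k * (L * 1)))
    ≡⟨ cong (λ z → s * (2 ^ (4 + v) * v * (32 * v) ^ k * z)) (^-distribˡ-+-* L k 1) ⟨
  s * (2 ^ (4 + v) * v * (32 * v) ^ k * L ^ (k + 1))
    ≤⟨ *-monoʳ-≤ s (*-monoˡ-≤ (L ^ (k + 1)) (*-monoʳ-≤ (2 ^ (4 + v) * v) (^-monoʳ-≤ (32 * v) {{m*n≢0 32 v}} k≤e))) ⟩
  s * (densityConst v e * L ^ (k + 1))
    ≤⟨ *-monoʳ-≤ s dense ⟩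
  s ^ suc j ∎
  where
  open ≤-Reasoning
  ℓ≤ : suc L ≤ 2 * L
  ℓ≤ = ≤-trans (+-monoˡ-≤ L 1≤L) (≤-reflexive (cong (L +_) (sym (+-identityʳ L))))
  lemma₁ : ∀ v L → 16 * v * (2 * L) ≡ 32 * v * L
  lemma₁ = solve-∀
  lemma₂ : ∀ p L v s a b → 2 * (2 * p) * (2 * L * (v * s) + s * v * (2 * L)) * (a * b) ≡
                           s * (2 * (2 * (2 * (2 * p))) * v * a * (b * (L * 1)))
  lemma₂ = solve-∀

-- The defining inequality of the maximizer, κ * a ≤ b * j, transfers m ^ a > c * L ^ b to
-- every subgraph: m ^ j exceeds a constant times L ^ κ.
transfer : ∀ {m s L a b j κ v C D} → 1 ≤ L → 1 ≤ j → j ≤ v → 1 ≤ C * D ^ v → 1 ≤ D → κ * a ≤ b * j →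
  m ≤ D * s → (C * D ^ v) ^ a * L ^ b < m ^ a → C * L ^ κ ≤ s ^ j
transfer {m} {s} {L} {a} {b} {j} {κ} {v} {C} {D} 1≤L 1≤j j≤v 1≤CD 1≤D κa≤bj m≤ large = ≮⇒≥ λ small →
  <-irrefl refl (begin-strict
    (m ^ a) ^ j                        ≡⟨ trans (^-*-assoc m a j) (trans (cong (m ^_) (*-comm a j)) (sym (^-*-assoc m j a))) ⟩
    (m ^ j) ^ a                        ≤⟨ ^-monoˡ-≤ a (m^j≤ small) ⟩
    (C * D ^ v * L ^ κ) ^ a        ≡⟨ trans (^-distribʳ-* (C * D ^ v) (L ^ κ) a) (cong (Y *_) (^-*-assoc L κ a)) ⟩
    Y * L ^ (κ * a)                ≤⟨ *-monoʳ-≤ Y (^-monoʳ-≤ L κa≤bj) ⟩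
    Y * L ^ (b * j)                    ≤⟨ *-monoˡ-≤ (L ^ (b * j)) Y≤Y^j ⟩
    Y ^ j * L ^ (b * j)                ≡⟨ cong (Y ^ j *_) (^-*-assoc L b j) ⟨
    Y ^ j * (L ^ b) ^ j                ≡⟨ ^-distribʳ-* Y (L ^ b) j ⟨
    (Y * L ^ b) ^ j                    <⟨ ^-monoˡ-< j large ⟩
    (m ^ a) ^ j                        ∎)
  where
  open ≤-Reasoning
  instance
    L≢0 : NonZero L
    L≢0 = >-nonZero 1≤L
    j≢0 : NonZero j
    j≢0 = >-nonZero 1≤j
    D≢0 : NonZero D
    D≢0 = >-nonZero 1≤D
    CD≢0 : NonZero (C * D ^ v)
    CD≢0 = >-nonZero 1≤CD
  Y = (C * D ^ v) ^ a
  -- Raising `large` to the power `j` also raises the constant, which is harmless as it is at least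
  -- 1.
  Y≤Y^j : Y ≤ Y ^ j
  Y≤Y^j = ≤-trans (≤-reflexive (sym (^-identityʳ Y))) (^-monoʳ-≤ Y {{m^n≢0 (C * D ^ v) a}} 1≤j)
  m^j≤ : s ^ j < C * L ^ κ → m ^ j ≤ C * D ^ v * L ^ κ
  m^j≤ small = begin
    m ^ j                      ≤⟨ ^-monoˡ-≤ j m≤ ⟩
    (D * s) ^ j                ≡⟨ ^-distribʳ-* D s j ⟩
    D ^ j * s ^ j              ≤⟨ *-mono-≤ (^-monoʳ-≤ D j≤v) (<⇒≤ small) ⟩
    D ^ v * (C * L ^ κ)    ≡⟨ lemma (D ^ v) C (L ^ κ) ⟩
    C * D ^ v * L ^ κ      ∎
    where
    lemma : ∀ a b c → a * (b * c) ≡ b * a * c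
    lemma = solve-∀

-- Combination of the two random choices and the constant `c`

-- The bound on m enters only through its consequence s ^ (|J| - 1) ≥ C L ^ (e(J) + 1) for all J.
no-good-size : ∀ {r w} (F : RGraph r (suc w)) {n m s} →
  let v = suc w ; L = ⌊log₂ n ⌋ ; es = shadowEdges F in
  2 ≤ n → 16 + v ≤ s → 8 * v * s ≤ m → m ≤ 16 * v * s →
  (∀ J → 1 ≤ length (edgesIn es J) → 2 ≤ ∣ J ∣ →
     densityConst v (length es) * L ^ (length (edgesIn es J) + 1) ≤ s ^ (∣ J ∣ ∸ 1)) →
  ∀ {vG} (G : RGraph r vG) → TightlyConnected 2 G → ¬ Homomorphic G F → ¬ GoodSize F G n m
no-good-size {r} {w} F {n} {m} {s} 2≤n 16+v≤s lo hi dense G tight no-hom good = S-free S-copy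
  where
  open ≤-Reasoning
  v = suc w
  L = ⌊log₂ n ⌋
  ℓ = suc L
  q = 16 * v * ℓ
  es = shadowEdges F
  e = length es
  -- The summand `ℓ * (v * s)` pays for the `n ^ (v * s)` arrays, the summand `q` for the colours.
  Z = ℓ * (v * s) + q
  -- Makes `K-large` an equality for `suc X * Z` tuples, where `suc X = 2 * q ^ e`.
  K = 2 ^ (2 + v) * Z
  X = pred (2 * q ^ e)
  1≤L : 1 ≤ L
  1≤L = ⌊log₂⌋-mono-≤ 2≤n
  n≤2^ℓ : n ≤ 2 ^ ℓ
  n≤2^ℓ = <⇒≤ (n<2^[1+log₂n] n)
  16≤s : 16 ≤ s
  16≤s = ≤-trans (m≤m+n 16 v) 16+v≤s
  v≤s : v ≤ s
  v≤s = ≤-trans (m≤n+m v 16) 16+v≤s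
  s≤m : s ≤ m
  s≤m = ≤-trans (m≤n*m s (8 * v)) lo
  instance
    s≢0 : NonZero s
    s≢0 = >-nonZero (≤-trans (s≤s z≤n) 16≤s)
    Z≢0 : NonZero Z
    Z≢0 = >-nonZero (≤-trans (s≤s z≤n) (m≤n+m q (ℓ * (v * s))))
    K≢0 : NonZero K
    K≢0 = m*n≢0 (2 ^ (2 + v)) Z {{m^n≢0 2 (2 + v)}}
    2Q≢0 : NonZero (2 * q ^ e)
    2Q≢0 = m*n≢0 2 (q ^ e) {{_}} {{m^n≢0 q e}}
  2Q≡ : 2 * q ^ e ≡ suc X
  2Q≡ = sym (suc-pred (2 * q ^ e))

  balancedΨ = balanced w n s (m ∸ s) q
    (balanced-bound w s (m ∸ s) n ℓ n≤2^ℓ (s≤s z≤n) (≤-trans (s≤s z≤n) 16≤s) v≤s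
      (subst (8 * v * s ≤_) (sym (m+[n∸m]≡n s≤m)) lo) (subst (_≤ 16 * v * s) (sym (m+[n∸m]≡n s≤m)) hi))
  Ψ = proj₁ balancedΨ

  edge-size : ∀ {d} → d ∈ₗ es → ∣ d ∣ ≡ 2
  edge-size d∈ = uniform (shadow2 F) _ (∈-shadowEdges⁻ F d∈)

  ∣J∣≥2 : ∀ J → 1 ≤ length (edgesIn es J) → 2 ≤ ∣ J ∣
  ∣J∣≥2 J 1≤ with numEdges≥1 (D (induced F J)) (subst (1 ≤_) (length-edgesIn F J) 1≤)
  ... | d , d∈ = subst (_≤ ∣ J ∣) (uniform (shadow2 F) d (D⊆E (induced F J) d d∈))
                   (p⊆q⇒∣p∣≤∣q∣ (D⊆W (induced F J) d d∈))

  J-dense : ∀ J → 1 ≤ length (edgesIn es J) → K * q ^ length (edgesIn es J) ≤ s ^ ∣ J ∣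
  J-dense J 1≤ = subst (λ k → K * q ^ length (edgesIn es J) ≤ s ^ k)
    (m+[n∸m]≡n (≤-trans (s≤s z≤n) (∣J∣≥2 J 1≤)))
    (density-bound v e s L (length (edgesIn es J)) (∣ J ∣ ∸ 1) 1≤L 16≤s
      (length-filter _ es) (dense J 1≤ (∣J∣≥2 J 1≤)))

  K-large : 2 * (suc X * Z) * 2 ^ v ≤ K * q ^ e
  K-large = ≤-reflexive (begin-equality
    2 * (suc X * Z) * 2 ^ v        ≡⟨ cong (λ k → 2 * (k * Z) * 2 ^ v) 2Q≡ ⟨
    2 * (2 * q ^ e * Z) * 2 ^ v    ≡⟨ lemma (q ^ e) Z (2 ^ v) ⟩
    K * q ^ e                      ∎)
    where
    lemma : ∀ a b c → 2 * (2 * a * b) * c ≡ 2 * (2 * c) * b * a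
    lemma = solve-∀

  sparse = sparse-list {s} {v} q es K (suc X * Z) J-dense K-large (suc X * Z) ≤-refl

  colouredχ = colouring es (shadowEdges! F) (λ d → proj₁ (ends d)) (λ d → proj₂ (ends d))
    (λ d∈ → ends-spec _ (edge-size d∈)) {n} {s} {q} {Z} {X} (proj₁ sparse) (proj₂ (proj₂ sparse)) 2Q≡
    (proj₁ (proj₂ sparse)) (union-bound n ℓ (v * s) q n≤2^ℓ)
  χ = proj₁ colouredχ

  open Construction F Ψ χ
  S-good = good H (H-free zero G tight no-hom)
  S = proj₁ S-good
  S-free = proj₂ (proj₂ S-good)
  i-large = proj₂ balancedΨ S (trans (proj₁ (proj₂ S-good)) (sym (m+[n∸m]≡n s≤m)))
  i = proj₁ i-large
  transversals = array F Ψ χ i S (proj₂ i-large)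
  t-mono = proj₂ colouredχ i transversals (array-injective F Ψ χ i S (proj₂ i-large))
  S-copy : CopyIn F H S
  S-copy = copy F Ψ χ i S (proj₂ i-large) (proj₁ t-mono)
    (edge-cell-mono F χ transversals (proj₁ t-mono) (proj₂ t-mono))

theorem1p3 : (r : ℕ) → 3 ≤ r → {vF : ℕ} (F : RGraph r vF) →
    (F* : Subgraph (shadow2 F)) → IsMaximizer F F* →
    ∃ λ (c : ℕ) → {vG : ℕ} (G : RGraph r vG) →
    TightlyConnected 2 G → ¬ Homomorphic G F →
    ∃ λ (N : ℕ) → ∀ n → N ≤ n → ∀ m → GoodSize F G n m →
    m ^ (vSub F* ∸ 1) ≤ c * ⌊log₂ n ⌋ ^ (eSub F* + 1)
-- Without vertices there is no pair, so `F*` cannot have an edge.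
theorem1p3 r _ {zero} F F* (1≤e* , _) with numEdges≥1 (D F*) 1≤e*
... | [] , d∈ with uniform (shadow2 F) [] (D⊆E F* [] d∈)
...   | ()
-- The threshold 2 makes the logarithm positive; small m are absorbed by `c`.
theorem1p3 r _ {suc w} F F* (_ , maximal) = c , λ G tight no-hom → 2 , λ n 2≤n m good → bound G tight no-hom n 2≤n m good
  where
  open ≤-Reasoning
  v = suc w
  a = vSub F* ∸ 1
  b = eSub F* + 1
  es = shadowEdges F
  C = densityConst v (length es)
  -- From here on `s = m / (8 * v)` is at least `16 + v`: the 16 serves `density-bound`, the `v`
  -- serves `balanced-bound`.
  M₀ = (16 + v) * (8 * v)
  -- The first summand excludes `m < M₀`; the second is the constant of `transfer` with
  -- `D = 16 * v`, from `m ≤ 16 * v * s`.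
  c = M₀ ^ a + (C * (16 * v) ^ v) ^ a
  bound : ∀ {vG} (G : RGraph r vG) → TightlyConnected 2 G → ¬ Homomorphic G F →
          ∀ n → 2 ≤ n → ∀ m → GoodSize F G n m → m ^ a ≤ c * ⌊log₂ n ⌋ ^ b
  bound G tight no-hom n 2≤n m good = ≮⇒≥ λ large →
    no-good-size F 2≤n (16+v≤s large) lo (hi large) (dense large) G tight no-hom good
    where
    L = ⌊log₂ n ⌋
    s = m / (8 * v)
    1≤L : 1 ≤ L
    1≤L = ⌊log₂⌋-mono-≤ 2≤n
    instance
      L^b≢0 : NonZero (L ^ b)
      L^b≢0 = m^n≢0 L b {{>-nonZero 1≤L}}
    module _ (large : c * L ^ b < m ^ a) where
      M₀≤m : M₀ ≤ m
      M₀≤m = ≮⇒≥ λ m<M₀ → <-irrefl refl (begin-strict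
        m ^ a        ≤⟨ ^-monoˡ-≤ a (<⇒≤ m<M₀) ⟩
        M₀ ^ a       ≤⟨ m≤m+n _ _ ⟩
        c            ≤⟨ m≤m*n c (L ^ b) ⟩
        c * L ^ b    <⟨ large ⟩
        m ^ a        ∎)
      16+v≤s : 16 + v ≤ s
      16+v≤s = ≤-trans (≤-reflexive (sym (m*n/n≡m (16 + v) (8 * v)))) (/-monoˡ-≤ (8 * v) M₀≤m)
      hi : m ≤ 16 * v * s
      hi = begin
        m                             ≡⟨ m≡m%n+[m/n]*n m (8 * v) ⟩
        m % (8 * v) + s * (8 * v)     ≤⟨ +-monoˡ-≤ (s * (8 * v)) (<⇒≤ (m%n<n m (8 * v))) ⟩
        8 * v + s * (8 * v)           ≤⟨ +-monoˡ-≤ (s * (8 * v)) (m≤n*m (8 * v) s {{>-nonZero (≤-trans (s≤s z≤n) 16+v≤s)}}) ⟩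
        s * (8 * v) + s * (8 * v)     ≡⟨ lemma s v ⟩
        16 * v * s                    ∎
        where
        lemma : ∀ s v → s * (8 * v) + s * (8 * v) ≡ 16 * v * s
        lemma = solve-∀
      dense : ∀ J → 1 ≤ length (edgesIn es J) → 2 ≤ ∣ J ∣ →
              C * L ^ (length (edgesIn es J) + 1) ≤ s ^ (∣ J ∣ ∸ 1)
      dense J 1≤ 2≤∣J∣ = transfer {m} {s} {L} {a} {b} {∣ J ∣ ∸ 1} {length (edgesIn es J) + 1} {v} {C} {16 * v} 1≤L
        (∸-monoˡ-≤ 1 2≤∣J∣) (≤-trans (m∸n≤m ∣ J ∣ 1) (∣p∣≤n J)) 1≤CD (s≤s z≤n)
        (subst (λ k → (k + 1) * a ≤ b * (∣ J ∣ ∸ 1)) (sym (length-edgesIn F J))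
          (maximal (induced F J) (subst (1 ≤_) (length-edgesIn F J) 1≤)))
        hi (≤-<-trans (*-monoˡ-≤ (L ^ b) (m≤n+m _ (M₀ ^ a))) large)
        where
        1≤CD : 1 ≤ C * (16 * v) ^ v
        1≤CD = *-mono-≤ (*-mono-≤ (*-mono-≤ (m^n>0 2 (4 + v)) (s≤s (z≤n {w}))) (m^n>0 (32 * v) (length es)))
                        (m^n>0 (16 * v) v)
    lo : 8 * v * s ≤ m
    lo = ≤-trans (≤-reflexive (*-comm (8 * v) s)) (m/n*n≤m m (8 * v))
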